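{- Let $G$ be a toroidal triangulation. Any balanced 4-orientation of the angle map $A(G)$ is the 4-orientation corresponding to a (balanced) toroidal transversal structure of $G$.
   Context: A toroidal map is a finite graph embedded on the (oriented) torus such that all faces are homeomorphic to open disks. Loops and multiple edges are allowed, but throughout embedded graphs have no contractible loop (an edge enclosing a region homeomorphic to an open disk) and no homotopic multiple edges (two edges with the same extremities whose union encloses a region homeomorphic to an open disk). A toroidal triangulation is a toroidal map all of whose faces have size three. A cycle is a closed walk with no repeated vertices (a loop is a cycle of length one); it is contractible if it encloses a region homeomorphic to an open disk. A toroidal transversal structure of $G$ is an orientation and a coloring of the edges of $G$ with colors blue and red such that around every vertex the edges form, in counterclockwise order, a non-empty interval of outgoing blue edges, a non-empty interval of outgoing red edges, a non-empty interval of incoming blue edges, and a non-empty interval of incoming red edges. The angle map $A(G)$ is the bipartite toroidal map whose vertices are the vertices of $G$ (primal-vertices) and one vertex inside each face of $G$ (dual-vertices), with one edge for each angle (corner) of $G$, joining the vertex of the angle to the dual-vertex of the face containing the angle. A 4-orientation of $A(G)$ is an orientation of its edges in which every primal-vertex has outdegree exactly 4 and every dual-vertex has outdegree exactly 1. The 4-orientation corresponding to a toroidal transversal structure is obtained as follows: the edge of $A(G)$ associated with an angle at a vertex $v$ is oriented toward $v$ if the two edges of $G$ bounding this angle have the same color, and toward its dual-vertex otherwise. Given an orientation of $A(G)$ and a cycle $C$ of $G$ with a direction of traversal, $\gamma(C)$ is the number of edges of $A(G)$ leaving $C$ (outgoing from vertices of $C$) on its right minus the number of edges of $A(G)$ leaving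 $C$ on its left. A 4-orientation is balanced if every non-contractible cycle $C$ of $G$ satisfies $\gamma(C)=0$; a toroidal transversal structure is balanced if its corresponding 4-orientation is. -}

module Defs where

open import Data.Bool.Base using (if_then_else_)
open import Data.Fin.Base using (Fin)
open import Data.Fin.Permutation using (Permutation′; _⟨$⟩ʳ_; _⟨$⟩ˡ_)
open import Data.Fin.Properties using (_≟_; all?)
open import Data.Fin.Subset using (Subset; _∈_; _∉_; ∣_∣)
open import Data.Fin.Subset.Properties using (_∈?_)
open import Data.Integer.Base using (ℤ; _⊖_; 0ℤ)
open import Data.List.Base
  using (List; []; _∷_; _++_; _∷ʳ_; map; zip; filter; allFin; iterate;
         length; replicate; reverse; takeWhile)
import Data.List.Membership.Propositional as List
open import Data.List.Relation.Unary.All using (All)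
open import Data.List.Relation.Unary.Unique.Propositional using (Unique)
open import Data.Nat.Base using (ℕ; suc; _+_; NonZero)
open import Data.Nat.ListAction using (sum)
open import Data.Product.Base using (∃; _×_; _,_; uncurry)
open import Data.Sum.Base using (_⊎_; inj₁; inj₂)
open import Data.Sum.Properties using (≡-dec)
open import Function.Bundles using (_⇔_)
open import Relation.Binary.Construct.Closure.ReflexiveTransitive using (Star)
open import Relation.Binary.Definitions using (DecidableEquality)
open import Relation.Binary.PropositionalEquality using (_≡_; _≢_; refl)
open import Relation.Nullary using (¬_; Dec; yes; no; does; ¬?)
open import Relation.Nullary.Decidable using (_→-dec_)
open import Relation.Unary using (Decidable)

count : ∀ {n} {P : Fin n → Set} → Decidable P → ℕ
count {n} P? = length (filter P? (allFin n))

-- A labelling of the orbits of f by an initial segment of ℕ; f is always a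
-- permutation below, so that Star (λ d e → f d ≡ e) is "same orbit".
record Orbits {n : ℕ} (f : Fin n → Fin n) : Set where
  field
    size       : ℕ
    label      : Fin n → Fin size
    surjective : ∀ i → ∃ λ d → label d ≡ i
    sameOrbit  : ∀ {d e} → label d ≡ label e ⇔ Star (λ x y → f x ≡ y) d e

-- Graphs cellularly embedded in the oriented torus, as combinatorial maps.
-- A dart is an edge with a direction of traversal.  σ is the counterclockwise
-- rotation of the darts around their tails, α reverses darts.  Walking along d
-- with a face on the left, the next dart on the boundary of that face is the
-- clockwise successor of α d, i.e. σ⁻¹ (α d).
record ToroidalMap : Set where
  field
    darts        : ℕ
    {{nonEmpty}} : NonZero darts

  Dart : Set
  Dart = Fin darts

  field
    rotation     : Permutation′ darts
    α            : Dart → Dart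
    α-involutive : ∀ d → α (α d) ≡ d
    α-free       : ∀ d → α d ≢ d

  σ : Dart → Dart
  σ d = rotation ⟨$⟩ʳ d

  φ : Dart → Dart
  φ d = rotation ⟨$⟩ˡ α d

  field
    vertices  : Orbits σ
    edges     : Orbits α
    faces     : Orbits φ
    connected : ∀ d e → Star (λ x y → σ x ≡ y ⊎ α x ≡ y) d e
    genusOne  : Orbits.size vertices + Orbits.size faces ≡ Orbits.size edges

  Vertex : Set
  Vertex = Fin (Orbits.size vertices)

  Edge : Set
  Edge = Fin (Orbits.size edges)

  Face : Set
  Face = Fin (Orbits.size faces)

  -- tail d is the vertex d leaves, face d is the face on the left of d.
  tail : Dart → Vertex
  tail = Orbits.label vertices

  head : Dart → Vertex
  head d = tail (α d)

  edge : Dart → Edge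
  edge = Orbits.label edges

  face : Dart → Face
  face = Orbits.label faces

  degree : Vertex → ℕ
  degree v = count (λ d → tail d ≟ v)

  faceSize : Face → ℕ
  faceSize f = count (λ d → face d ≟ f)

module _ (G : ToroidalMap) where
  open ToroidalMap G

  -- The pairs of cyclically consecutive darts.
  turns : List Dart → List (Dart × Dart)
  turns []       = []
  turns (d ∷ ds) = zip (d ∷ ds) (ds ∷ʳ d)

  IsClosedWalk : List Dart → Set
  IsClosedWalk C = C ≢ [] × All (uncurry λ d e → head d ≡ tail e) (turns C)

  reverseWalk : List Dart → List Dart
  reverseWalk C = reverse (map α C)

  -- Distinctness of the edges only excludes the walks that go along a non-loop
  -- edge and straight back.
  record IsCycle (C : List Dart) : Set where
    field
      closedWalk       : IsClosedWalk C
      distinctVertices : Unique (map tail C)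
      distinctEdges    : Unique (map edge C)

  -- A cell (vertex, edge or face, according to the labelling) lies in the
  -- interior of the union of the closed faces of R when all the faces around it
  -- belong to R.
  Interior : ∀ {f : Dart → Dart} (cells : Orbits f) →
             Subset (Orbits.size faces) → Fin (Orbits.size cells) → Set
  Interior cells R i = ∀ d → Orbits.label cells d ≡ i → face d ∈ R

  interior? : ∀ {f : Dart → Dart} (cells : Orbits f) R → Decidable (Interior cells R)
  interior? cells R i = all? λ d → (Orbits.label cells d ≟ i) →-dec (face d ∈? R)

  Adjacent : Subset (Orbits.size faces) → Face → Face → Set
  Adjacent R f g = f ∈ R × g ∈ R × ∃ λ d → face d ≡ f × face (α d) ≡ g

  -- The darts of C are exactly those with the region on their left and its
  -- complement on their right, and the open region is an open disk.  The open
  -- region is a union of open cells and a proper open subset of the torus; such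
  -- a surface is an open disk iff it is connected with (compactly supported)
  -- Euler characteristic 1.
  record EnclosesDiskOnLeft (C : List Dart) : Set where
    field
      region    : Subset (Orbits.size faces)
      boundary  : ∀ d → d List.∈ C ⇔ (face d ∈ region × face (α d) ∉ region)
      connected : ∀ {f g} → f ∈ region → g ∈ region → Star (Adjacent region) f g
      euler     : count (interior? vertices region) + ∣ region ∣
                  ≡ count (interior? edges region) + 1

  Contractible : List Dart → Set
  Contractible C = EnclosesDiskOnLeft C ⊎ EnclosesDiskOnLeft (reverseWalk C)

  NoContractibleLoop : Set
  NoContractibleLoop = ∀ d → tail d ≡ head d → ¬ Contractible (d ∷ [])

  -- The region has to be bounded by d followed by the reverse of e, so that two
  -- loops whose union merely cuts the torus open into a disk are not homotopic.
  NoHomotopicMultipleEdges : Set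
  NoHomotopicMultipleEdges =
    ∀ d e → edge d ≢ edge e → tail d ≡ tail e → head d ≡ head e →
    ¬ Contractible (d ∷ α e ∷ [])

record ToroidalTriangulation : Set where
  field
    toroidalMap              : ToroidalMap
    noContractibleLoop       : NoContractibleLoop toroidalMap
    noHomotopicMultipleEdges : NoHomotopicMultipleEdges toroidalMap
    triangular               : ∀ f → ToroidalMap.faceSize toroidalMap f ≡ 3

data Colour : Set where
  blue red : Colour

_≟ᶜ_ : DecidableEquality Colour
blue ≟ᶜ blue = yes refl
blue ≟ᶜ red  = no λ ()
red  ≟ᶜ blue = no λ ()
red  ≟ᶜ red  = yes refl

data Heading : Set where
  outgoing incoming : Heading

data Target : Set where
  toPrimal toDual : Target

module _ (G : ToroidalMap) where
  open ToroidalMap G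

  -- The angle map A(G).  The angle between d and σ d, at tail d and in face d,
  -- is named by d.
  Angle : Set
  Angle = Dart

  AngleVertex : Set
  AngleVertex = Vertex ⊎ Face

  AngleOrientation : Set
  AngleOrientation = Angle → Target

  source : AngleOrientation → Angle → AngleVertex
  source D a with D a
  ... | toDual   = inj₁ (tail a)
  ... | toPrimal = inj₂ (face a)

  outdegree : AngleOrientation → AngleVertex → ℕ
  outdegree D x = count (λ a → ≡-dec _≟_ _≟_ (source D a) x)

  record Is4Orientation (D : AngleOrientation) : Set where
    field
      primal : ∀ v → outdegree D (inj₁ v) ≡ 4
      dual   : ∀ f → outdegree D (inj₂ f) ≡ 1

  -- The angles met when turning counterclockwise from d to e, for distinct
  -- darts d and e with the same tail.
  sector : Dart → Dart → List Angle
  sector d e = takeWhile (λ a → ¬? (a ≟ e)) (iterate σ d darts)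

  leaving : Target → ℕ
  leaving toDual   = 1
  leaving toPrimal = 0

  outgoingIn : AngleOrientation → List Angle → ℕ
  outgoingIn D angles = sum (map (λ a → leaving (D a)) angles)

  -- A walk that arrives along d and leaves along e has the sector from α d to e
  -- on its right and the sector from e to α d on its left.
  rightOutgoing leftOutgoing : AngleOrientation → List Dart → ℕ
  rightOutgoing D C = sum (map (uncurry λ d e → outgoingIn D (sector (α d) e)) (turns G C))
  leftOutgoing  D C = sum (map (uncurry λ d e → outgoingIn D (sector e (α d))) (turns G C))

  γ : AngleOrientation → List Dart → ℤ
  γ D C = rightOutgoing D C ⊖ leftOutgoing D C

  record IsBalanced4Orientation (D : AngleOrientation) : Set where
    field
      is4Orientation : Is4Orientation D
      balanced       : ∀ C → IsCycle G C → ¬ Contractible G C → γ D C ≡ 0ℤ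

  record OrientedColouring : Set where
    field
      colour      : Edge → Colour
      orient      : Edge → Dart
      orient-edge : ∀ e → edge (orient e) ≡ e

    heading : Dart → Heading
    heading d = if does (orient (edge d) ≟ d) then outgoing else incoming

    kind : Dart → Heading × Colour
    kind d = heading d , colour (edge d)

  -- iterate σ d (degree v) lists the darts around v counterclockwise from d.
  TransversalAt : OrientedColouring → Vertex → Set
  TransversalAt T v =
    ∃ λ d → tail d ≡ v × ∃ λ k → ∃ λ l → ∃ λ m → ∃ λ n →
      map kind (iterate σ d (degree v))
        ≡ replicate (suc k) (outgoing , blue) ++ replicate (suc l) (outgoing , red)
       ++ replicate (suc m) (incoming , blue) ++ replicate (suc n) (incoming , red)
    where open OrientedColouring T

  record TransversalStructure : Set where
    field
      orientedColouring : OrientedColouring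
      transversal       : ∀ v → TransversalAt orientedColouring v

    open OrientedColouring orientedColouring public

  corresponding : TransversalStructure → AngleOrientation
  corresponding T a =
    if does (colour (edge a) ≟ᶜ colour (edge (σ a))) then toPrimal else toDual
    where open TransversalStructure T

  IsBalancedStructure : TransversalStructure → Set
  IsBalancedStructure T = IsBalanced4Orientation (corresponding T)

-- Measure turning in quarter turns: passing over an angle that leaves its vertex
-- counts one, reversing a dart counts two.  An orientation comes from a
-- transversal structure once the darts can be given values in ℤ/4 that follow
-- these turns (outgoing blue, outgoing red, incoming blue, incoming red being
-- 0, 1, 2, 3), that is, once every closed walk turns by a multiple of four.
-- Turning is the sum of a 1-form on darts.  The outdegree conditions make its
-- sums around edges and faces vanish mod 4, so by Stokes it vanishes on every
-- cycle that bounds a region; on the other cycles it vanishes because γ = 0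
-- gives as many quarters on the right as on the left.  An arbitrary closed walk
-- is cut into cycles at repeated vertices and edges.

module Submission where

open import Defs
open import Data.Bool.Base using (true; false; if_then_else_)
open import Data.Empty using (⊥-elim)
open import Data.Fin.Base using (Fin; toℕ; fromℕ<)
open import Data.Fin.Permutation using (_⟨$⟩ˡ_; inverseˡ; inverseʳ)
open import Data.Fin.Properties
  using (_≟_; pigeonhole; ¬∀⟶∃¬-smallest; toℕ<n; toℕ-fromℕ<; toℕ-inject)
open import Data.Fin.Subset using (Subset) renaming (_∈_ to _∈ˢ_; _∉_ to _∉ˢ_)
open import Data.Fin.Subset.Properties using () renaming (_∈?_ to _∈ˢ?_)
open import Data.Integer.Base using (0ℤ; _⊖_)
import Data.Integer.Properties as ℤ
open import Data.List.Base
  using (List; []; _∷_; _++_; _∷ʳ_; map; zip; filter; allFin; iterate; length; replicate;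
         applyUpTo; takeWhile)
open import Data.List.Membership.DecPropositional using () renaming (_∈?_ to ∈?)
open import Data.List.Membership.Propositional using (_∈_)
open import Data.List.Membership.Propositional.Properties
  using (∈-allFin; ∈-applyUpTo⁺; ∈-applyUpTo⁻; ∈-filter⁺; ∈-filter⁻; ∈-map⁺; ∈-map⁻; ∈-∃++)
open import Data.List.Membership.Propositional.Properties.WithK using (unique∧set⇒bag)
open import Data.List.Properties
  using (map-++; map-cong; map-∘; length-++; length-iterate; filter-≐; ++-identityʳ)
open import Data.List.Relation.Binary.BagAndSetEquality using (∼bag⇒↭)
open import Data.List.Relation.Binary.Permutation.Propositional using (_↭_; ↭-sym)
open import Data.List.Relation.Binary.Permutation.Propositional.Properties
  using (∈-resp-↭; ↭-length; ↭-reverse) renaming (map⁺ to ↭-map⁺)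
open import Data.List.Relation.Unary.All using (All; []; _∷_; lookup)
import Data.List.Relation.Unary.All as All
import Data.List.Relation.Unary.All.Properties as All
open import Data.List.Relation.Unary.AllPairs using (AllPairs; []; _∷_)
import Data.List.Relation.Unary.AllPairs.Properties as AllPairs
open import Data.List.Relation.Unary.Any using (here; there)
open import Data.List.Relation.Unary.Unique.Propositional using (Unique)
import Data.List.Relation.Unary.Unique.Propositional.Properties as Unique
open import Data.Nat.Base
  using (ℕ; zero; suc; _+_; _*_; _∸_; _≤_; _<_; z≤n; s≤s; z<s; s≤s⁻¹; s<s⁻¹;
         NonZero; >-nonZero; >-nonZero⁻¹)
open import Data.Nat.DivMod
  using (_%_; _/_; %-distribˡ-+; [m+kn]%n≡m%n; m≡m%n+[m/n]*n; m%n<n)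
open import Data.Nat.GeneralisedArithmetic using () renaming (iterate to iter)
open import Data.Nat.ListAction using (sum)
open import Data.Nat.ListAction.Properties using (sum-++; sum-↭)
import Data.Nat.Properties as ℕ
open import Data.Nat.Tactic.RingSolver using (solve-∀)
open import Data.Product using (∃; _×_; _,_; proj₁; proj₂; uncurry)
open import Data.Sum.Base using (_⊎_; inj₁; inj₂)
open import Data.Sum.Properties using (≡-dec)
open import Function.Base using (_∘_)
open import Function.Bundles using (_⇔_; mk⇔; module Equivalence)
open import Relation.Binary.Bundles using (Setoid)
open import Relation.Binary.Construct.Closure.ReflexiveTransitive using (Star; ε; _◅_)
open import Relation.Binary.PropositionalEquality
  using (_≡_; _≢_; refl; sym; trans; cong; cong₂; subst; module ≡-Reasoning)
import Relation.Binary.Reasoning.Setoid as SetoidReasoning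
open import Relation.Nullary using (Dec; yes; no; does; ¬_; ¬?)
open import Relation.Nullary.Decidable using (map′; _×-dec_; decidable-stable)
open import Relation.Unary using (Decidable)

-- A turn happens between two consecutive darts, whereas Stokes needs a quantity carried by single
-- darts. A base dart chosen at each vertex turns the passage from one dart to the next into a
-- difference of two angles, and each dart receives the angles at its two ends; this is `holonomy`.
-- An angle is only determined up to a full turn, which is four quarters, so all values live modulo
-- four. They are kept as natural numbers, with 3 as the coefficient -1. Once closed walks have
-- holonomy 0, summing along walks from a root gives a potential on vertices, and potential plus
-- angle is the value in ℤ/4 of a dart. It no longer depends on how the bases at different vertices
-- relate to each other.

-- Congruence modulo four on natural numbers

infix 4 _≋_

-- A record instead of the bare equation, so that `m` and `n` can be recovered from the type by
-- unification.
record _≋_ (m n : ℕ) : Set where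
  constructor mod≡
  field
    %≡% : m % 4 ≡ n % 4

open _≋_

≋-setoid : Setoid _ _
≋-setoid = record
  { Carrier       = ℕ
  ; _≈_           = _≋_
  ; isEquivalence = record
    { refl  = mod≡ refl
    ; sym   = λ p → mod≡ (sym (%≡% p))
    ; trans = λ p q → mod≡ (trans (%≡% p) (%≡% q))
    }
  }

open Setoid ≋-setoid using ()
  renaming (refl to ≋-refl; sym to ≋-sym; trans to ≋-trans; reflexive to ≋-reflexive)

module ≋-Reasoning = SetoidReasoning ≋-setoid

_≋?_ : ∀ m n → Dec (m ≋ n)
m ≋? n = map′ mod≡ %≡% (m % 4 ℕ.≟ n % 4)

+-cong-≋ : ∀ {a b c d} → a ≋ b → c ≋ d → a + c ≋ b + d
+-cong-≋ {a} {b} {c} {d} (mod≡ p) (mod≡ q) = mod≡ (begin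
  (a + c) % 4             ≡⟨ %-distribˡ-+ a c 4 ⟩
  (a % 4 + c % 4) % 4     ≡⟨ cong₂ (λ x y → (x + y) % 4) p q ⟩
  (b % 4 + d % 4) % 4     ≡⟨ %-distribˡ-+ b d 4 ⟨
  (b + d) % 4             ∎)
  where open ≡-Reasoning

+-congˡ-≋ : ∀ a {c d} → c ≋ d → a + c ≋ a + d
+-congˡ-≋ a = +-cong-≋ (≋-refl {a})

+-congʳ-≋ : ∀ c {a b} → a ≋ b → a + c ≋ b + c
+-congʳ-≋ c p = +-cong-≋ p (≋-refl {c})

+4*-≋ : ∀ m k → m + 4 * k ≋ m
+4*-≋ m k = mod≡ (trans (cong (λ x → (m + x) % 4) (ℕ.*-comm 4 k)) ([m+kn]%n≡m%n m k 4))

-- Adding `3 * c` takes the place of subtracting `c`.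
+-cancelʳ-≋ : ∀ c {a b} → a + c ≋ b + c → a ≋ b
+-cancelʳ-≋ c {a} {b} p = begin
  a                 ≈⟨ +4*-≋ a c ⟨
  a + 4 * c         ≡⟨ regroup a c ⟩
  a + c + 3 * c     ≈⟨ +-congʳ-≋ (3 * c) p ⟩
  b + c + 3 * c     ≡⟨ regroup b c ⟨
  b + 4 * c         ≈⟨ +4*-≋ b c ⟩
  b                 ∎
  where
  open ≋-Reasoning
  regroup : ∀ a c → a + 4 * c ≡ a + c + 3 * c
  regroup = solve-∀

3*-cong-≋ : ∀ {a b} → a ≋ b → 3 * a ≋ 3 * b
3*-cong-≋ p = +-cong-≋ p (+-cong-≋ p (+-cong-≋ p ≋-refl))

-- Finite sums over lists and over fibres of a labelling

private
  variable
    A B : Set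

∑ : List A → (A → ℕ) → ℕ
∑ xs f = sum (map f xs)

syntax ∑ xs (λ x → e) = ∑[ x ∈ xs ] e

∑-cong : {f h : A → ℕ} (xs : List A) → (∀ x → f x ≡ h x) → ∑ xs f ≡ ∑ xs h
∑-cong xs f≗h = cong sum (map-cong f≗h xs)

∑-cong-≋ : {f h : A → ℕ} (xs : List A) → (∀ x → x ∈ xs → f x ≋ h x) → ∑ xs f ≋ ∑ xs h
∑-cong-≋ []       p = ≋-refl
∑-cong-≋ (x ∷ xs) p = +-cong-≋ (p x (here refl)) (∑-cong-≋ xs λ y y∈xs → p y (there y∈xs))

∑-++ : (f : A → ℕ) (xs ys : List A) → ∑ (xs ++ ys) f ≡ ∑ xs f + ∑ ys f
∑-++ f xs ys = trans (cong sum (map-++ f xs ys)) (sum-++ (map f xs) (map f ys))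

∑-↭ : (f : A → ℕ) {xs ys : List A} → xs ↭ ys → ∑ xs f ≡ ∑ ys f
∑-↭ f p = sum-↭ (↭-map⁺ f p)

∑-+ : (f h : A → ℕ) (xs : List A) → ∑[ x ∈ xs ] (f x + h x) ≡ ∑ xs f + ∑ xs h
∑-+ f h []       = refl
∑-+ f h (x ∷ xs) rewrite ∑-+ f h xs = interchange (f x) (h x) (∑ xs f) (∑ xs h)
  where
  interchange : ∀ a b c d → a + b + (c + d) ≡ a + c + (b + d)
  interchange = solve-∀

∑-* : (k : ℕ) (f : A → ℕ) (xs : List A) → ∑[ x ∈ xs ] (k * f x) ≡ k * ∑ xs f
∑-* k f []       = sym (ℕ.*-zeroʳ k)
∑-* k f (x ∷ xs) = trans (cong (k * f x +_) (∑-* k f xs)) (sym (ℕ.*-distribˡ-+ k (f x) (∑ xs f)))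

∑-const : (k : ℕ) (xs : List A) → ∑[ _ ∈ xs ] k ≡ k * length xs
∑-const k []       = sym (ℕ.*-zeroʳ k)
∑-const k (x ∷ xs) = trans (cong (k +_) (∑-const k xs)) (sym (ℕ.*-suc k (length xs)))

∑-swap : (f : A → B → ℕ) (xs : List A) (ys : List B) →
         ∑[ x ∈ xs ] (∑[ y ∈ ys ] f x y) ≡ ∑[ y ∈ ys ] (∑[ x ∈ xs ] f x y)
∑-swap f []       ys = sym (∑-const 0 ys)
∑-swap f (x ∷ xs) ys = trans (cong (∑ ys (f x) +_) (∑-swap f xs ys))
                             (sym (∑-+ (f x) (λ y → ∑[ x ∈ xs ] f x y) ys))

∑-filter : {P : A → Set} (P? : Decidable P) (f : A → ℕ) (xs : List A) →
           ∑ (filter P? xs) f ≡ ∑[ x ∈ xs ] (if does (P? x) then f x else 0)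
∑-filter P? f []       = refl
∑-filter P? f (x ∷ xs) with does (P? x)
... | true  = cong (f x +_) (∑-filter P? f xs)
... | false = ∑-filter P? f xs

∑-filter-split : {P Q : A → Set} (P? : Decidable P) (Q? : Decidable Q) (f : A → ℕ) (xs : List A) →
  ∑ (filter P? xs) f
    ≡ ∑ (filter (λ x → P? x ×-dec ¬? (Q? x)) xs) f + ∑ (filter (λ x → P? x ×-dec Q? x) xs) f
∑-filter-split P? Q? f []       = refl
∑-filter-split P? Q? f (x ∷ xs) with P? x | Q? x
... | yes _ | no _  = trans (cong (f x +_) (∑-filter-split P? Q? f xs)) (sym (ℕ.+-assoc (f x) _ _))
... | yes _ | yes _ = trans (cong (f x +_) (∑-filter-split P? Q? f xs)) (swap (f x) (∑ (filter _ xs) f) _)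
  where
  swap : ∀ a b c → a + (b + c) ≡ b + (a + c)
  swap = solve-∀
... | no _  | _     = ∑-filter-split P? Q? f xs

length-filter : {P : A → Set} (P? : Decidable P) (xs : List A) →
                length (filter P? xs) ≡ ∑[ x ∈ xs ] (if does (P? x) then 1 else 0)
length-filter P? xs = trans (trans (sym (ℕ.*-identityˡ _)) (sym (∑-const 1 (filter P? xs))))
                            (∑-filter P? (λ _ → 1) xs)

unique-↭ : {xs ys : List A} → Unique xs → Unique ys →
           (∀ {x} → x ∈ xs → x ∈ ys) → (∀ {x} → x ∈ ys → x ∈ xs) → xs ↭ ys
unique-↭ !xs !ys xs⊆ys ys⊆xs = ∼bag⇒↭ (unique∧set⇒bag !xs !ys (mk⇔ xs⊆ys ys⊆xs))

filter-allFin-↭ : ∀ {n} {P : Fin n → Set} (P? : Decidable P) {xs} → Unique xs →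
                  (∀ {x} → x ∈ xs → P x) → (∀ {x} → P x → x ∈ xs) → xs ↭ filter P? (allFin n)
filter-allFin-↭ {n} P? !xs sound complete = unique-↭ !xs (Unique.filter⁺ P? (Unique.allFin⁺ n))
  (λ x∈xs → ∈-filter⁺ P? (∈-allFin _) (sound x∈xs))
  (λ x∈ → complete (proj₂ (∈-filter⁻ P? {xs = allFin n} x∈)))

∑-allFin-point : ∀ {n} (h : Fin n → ℕ) (j : Fin n) →
  ∑[ i ∈ allFin n ] (if does (j ≟ i) then h i else 0) ≡ h j
∑-allFin-point {n} h j = begin
  ∑[ i ∈ allFin n ] (if does (j ≟ i) then h i else 0) ≡⟨ ∑-filter (j ≟_) h (allFin n) ⟨
  ∑ (filter (j ≟_) (allFin n)) h                      ≡⟨ ∑-↭ h single ⟨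
  h j + 0                                             ≡⟨ ℕ.+-identityʳ (h j) ⟩
  h j                                                 ∎
  where
  open ≡-Reasoning
  single : j ∷ [] ↭ filter (j ≟_) (allFin n)
  single = filter-allFin-↭ (j ≟_) ([] ∷ []) (λ { (here refl) → refl }) (λ { refl → here refl })

-- `P` is constant on the fibres of `label`, so each fibre is kept or dropped as a whole, as any one
-- of its elements decides. Applied once to faces and once to edges, this supplies both halves of
-- Stokes.
∑-fibres-≋0 : ∀ {m n} (label : Fin n → Fin m) → (∀ i → ∃ λ d → label d ≡ i) →
  (u : Fin n → ℕ) → (∀ i → ∑ (filter (λ d → label d ≟ i) (allFin n)) u ≋ 0) →
  {P : Fin n → Set} (P? : Decidable P) → (∀ {d e} → label d ≡ label e → P d → P e) →
  ∑ (filter P? (allFin n)) u ≋ 0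
∑-fibres-≋0 {m} {n} label surjective u fibre P? resp = begin
  ∑ (filter P? (allFin n)) u
    ≡⟨ ∑-filter P? u (allFin n) ⟩
  ∑[ d ∈ allFin n ] (if does (P? d) then u d else 0)
    -- Each term is spread over all labels, with a single non-zero entry, so that the order of
    -- summation can be exchanged.
    ≡⟨ ∑-cong (allFin n) (λ d → ∑-allFin-point (λ _ → if does (P? d) then u d else 0) (label d)) ⟨
  ∑[ d ∈ allFin n ] (∑[ i ∈ allFin m ] (if does (label d ≟ i) then (if does (P? d) then u d else 0) else 0))
    ≡⟨ ∑-swap _ (allFin n) (allFin m) ⟩
  ∑[ i ∈ allFin m ] (∑[ d ∈ allFin n ] (if does (label d ≟ i) then (if does (P? d) then u d else 0) else 0))
    ≈⟨ ∑-cong-≋ (allFin m) (λ i _ → vanish i) ⟩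
  ∑[ _ ∈ allFin m ] 0
    ≡⟨ ∑-const 0 (allFin m) ⟩
  0 ∎
  where
  open ≋-Reasoning
  vanish : ∀ i → ∑[ d ∈ allFin n ] (if does (label d ≟ i) then (if does (P? d) then u d else 0) else 0) ≋ 0
  vanish i with surjective i
  ... | r , refl with P? r
  ...   | yes p = begin
    _                                           ≡⟨ ∑-cong (allFin n) inside ⟩
    _                                           ≡⟨ ∑-filter (λ d → label d ≟ label r) u (allFin n) ⟨
    ∑ (filter (λ d → label d ≟ label r) (allFin n)) u ≈⟨ fibre (label r) ⟩
    0                                           ∎
    where
    inside : ∀ d → (if does (label d ≟ label r) then (if does (P? d) then u d else 0) else 0)
                   ≡ (if does (label d ≟ label r) then u d else 0)
    inside d with label d ≟ label r
    ... | no _ = refl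
    ... | yes eq with P? d
    ...   | yes _ = refl
    ...   | no ¬p = ⊥-elim (¬p (resp (sym eq) p))
  ...   | no ¬p = ≋-reflexive (trans (∑-cong (allFin n) outside) (∑-const 0 (allFin n)))
    where
    outside : ∀ d → (if does (label d ≟ label r) then (if does (P? d) then u d else 0) else 0) ≡ 0
    outside d with label d ≟ label r
    ... | no _ = refl
    ... | yes eq with P? d
    ...   | yes q = ⊥-elim (¬p (resp eq q))
    ...   | no _ = refl

-- For a closed walk `z` is `x`. It is kept separate because the induction moves the first entry
-- while the closing one stays fixed.
∑-zip-rotate : (f h : A → ℕ) (x z : A) (xs : List A) →
  ∑[ p ∈ zip (x ∷ xs) (xs ∷ʳ z) ] (f (proj₁ p) + h (proj₂ p)) ≡ ∑ (x ∷ xs) f + (∑ xs h + h z)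
∑-zip-rotate f h x z []       = lemma (f x) (h z)
  where
  lemma : ∀ a b → a + b + 0 ≡ a + 0 + (0 + b)
  lemma = solve-∀
∑-zip-rotate f h x z (y ∷ ys) rewrite ∑-zip-rotate f h y z ys =
  lemma (f x) (h y) (f y) (∑ ys f) (∑ ys h) (h z)
  where
  lemma : ∀ a b c d e g → a + b + (c + d + (e + g)) ≡ a + (c + d) + (b + e + g)
  lemma = solve-∀

-- Iteration and the orbits of a permutation

module _ {A : Set} (f : A → A) where

  iter-+ : ∀ i j x → iter f x (i + j) ≡ iter f (iter f x i) j
  iter-+ zero    j x = refl
  iter-+ (suc i) j x = iter-+ i j (f x)

  iter-suc : ∀ i x → iter f x (suc i) ≡ f (iter f x i)
  iter-suc zero    x = refl
  iter-suc (suc i) x = iter-suc i (f x)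

  iter-injective : (∀ {x y} → f x ≡ f y → x ≡ y) → ∀ i {x y} → iter f x i ≡ iter f y i → x ≡ y
  iter-injective f-inj zero    eq = eq
  iter-injective f-inj (suc i) eq = f-inj (iter-injective f-inj i eq)

  iterate≡applyUpTo : ∀ x n → iterate f x n ≡ applyUpTo (iter f x) n
  iterate≡applyUpTo x zero    = refl
  iterate≡applyUpTo x (suc n) = cong (x ∷_) (iterate≡applyUpTo (f x) n)

  iterate-++ : ∀ i j x → iterate f x (i + j) ≡ iterate f x i ++ iterate f (iter f x i) j
  iterate-++ zero    j x = refl
  iterate-++ (suc i) j x = cong (x ∷_) (iterate-++ i j (f x))

  star⇒iter : ∀ {x y} → Star (λ x y → f x ≡ y) x y → ∃ λ i → iter f x i ≡ y
  star⇒iter ε          = 0 , refl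
  star⇒iter (refl ◅ s) with star⇒iter s
  ... | i , eq = suc i , eq

module Orbit {n : ℕ} {f : Fin n → Fin n} (f-injective : ∀ {d e} → f d ≡ f e → d ≡ e)
             (orbits : Orbits f) where
  open Orbits orbits

  label-f : ∀ d → label (f d) ≡ label d
  label-f d = sym (Equivalence.from sameOrbit (refl ◅ ε))

  label-iter : ∀ i d → label (iter f d i) ≡ label d
  label-iter zero    d = refl
  label-iter (suc i) d = trans (label-iter i (f d)) (label-f d)

  -- The size of the orbit, and not the least return time, so that for the rotation it is `degree`
  -- by definition; `q≡period` identifies the two.
  period : Fin n → ℕ
  period d = count (λ e → label e ≟ label d)

  cancel : ∀ d {i j} → i < j → iter f d i ≡ iter f d j → iter f d (j ∸ i) ≡ d
  cancel d {i} {j} i<j eq = sym (iter-injective f f-injective i (begin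
    iter f d i                     ≡⟨ eq ⟩
    iter f d j                     ≡⟨ cong (iter f d) (ℕ.m∸n+n≡m (ℕ.<⇒≤ i<j)) ⟨
    iter f d (j ∸ i + i)           ≡⟨ iter-+ f (j ∸ i) i d ⟩
    iter f (iter f d (j ∸ i)) i    ∎))
    where open ≡-Reasoning

  abstract
    -- Two of the `n + 1` iterates from 0 to `n` coincide, and cancelling the smaller exponent gives
    -- a return within `n` steps. The search index `i` stands for `suc (toℕ i)` steps, which
    -- excludes the trivial return.
    leastReturn : ∀ d → ∃ λ q → 0 < q × q ≤ n × iter f d q ≡ d ×
                                (∀ j → suc j < q → iter f d (suc j) ≢ d)
    leastReturn d with ¬∀⟶∃¬-smallest n (λ i → iter f d (suc (toℕ i)) ≢ d)
                                      (λ i → ¬? (iter f d (suc (toℕ i)) ≟ d)) returns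
      where
      returns : ¬ (∀ (i : Fin n) → iter f d (suc (toℕ i)) ≢ d)
      returns never with pigeonhole (ℕ.n<1+n n) (λ i → iter f d (toℕ i))
      ... | i , j , i<j , eq with toℕ j ∸ toℕ i | ℕ.m<n⇒0<n∸m i<j | ℕ.m∸n≤m (toℕ j) (toℕ i)
                                | cancel d i<j eq
      ...   | suc m | _ | m<j | back =
        never (fromℕ< m<n) (trans (cong (λ k → iter f d (suc k)) (toℕ-fromℕ< m<n)) back)
        where
        m<n : m < n
        m<n = ℕ.≤-trans m<j (s≤s⁻¹ (toℕ<n j))
    ... | i , ¬≢ , least = suc (toℕ i) , s≤s z≤n , toℕ<n i , decidable-stable (_ ≟ d) ¬≢ ,
      λ j j<i → subst (λ k → iter f d (suc k) ≢ d)
                      (trans (toℕ-inject (fromℕ< (s<s⁻¹ j<i))) (toℕ-fromℕ< (s<s⁻¹ j<i)))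
                      (least (fromℕ< (s<s⁻¹ j<i)))

  private
    module Return (d : Fin n) where
      q : ℕ
      q = proj₁ (leastReturn d)

      instance
        q≢0 : NonZero q
        q≢0 = >-nonZero (proj₁ (proj₂ (leastReturn d)))

      q≤n : q ≤ n
      q≤n = proj₁ (proj₂ (proj₂ (leastReturn d)))

      iter-q : iter f d q ≡ d
      iter-q = proj₁ (proj₂ (proj₂ (proj₂ (leastReturn d))))

      least : ∀ j → suc j < q → iter f d (suc j) ≢ d
      least = proj₂ (proj₂ (proj₂ (proj₂ (leastReturn d))))

      distinct : ∀ {i j} → i < j → j < q → iter f d i ≢ iter f d j
      distinct {i} {j} i<j j<q eq with j ∸ i | ℕ.m<n⇒0<n∸m i<j | ℕ.m∸n≤m j i | cancel d i<j eq
      ... | suc m | _ | m<j | back =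
        least m (ℕ.≤-<-trans m<j j<q) back

      iter-q* : ∀ k → iter f d (k * q) ≡ d
      iter-q* zero    = refl
      iter-q* (suc k) = trans (iter-+ f q (k * q) d) (trans (cong (λ e → iter f e (k * q)) iter-q) (iter-q* k))

      find-q : ∀ {e} → label d ≡ label e → ∃ λ i → i < q × iter f d i ≡ e
      find-q eq with star⇒iter f (Equivalence.to sameOrbit eq)
      ... | i , refl = i % q , m%n<n i q , sym (begin
        iter f d i                              ≡⟨ cong (iter f d) (m≡m%n+[m/n]*n i q) ⟩
        iter f d (i % q + i / q * q)            ≡⟨ cong (iter f d) (ℕ.+-comm (i % q) _) ⟩
        iter f d (i / q * q + i % q)            ≡⟨ iter-+ f (i / q * q) (i % q) d ⟩
        iter f (iter f d (i / q * q)) (i % q)   ≡⟨ cong (λ e → iter f e (i % q)) (iter-q* (i / q)) ⟩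
        iter f d (i % q)                        ∎)
        where open ≡-Reasoning

      orbit-q-↭ : iterate f d q ↭ filter (λ e → label e ≟ label d) (allFin n)
      orbit-q-↭ = filter-allFin-↭ (λ e → label e ≟ label d)
        (subst Unique (sym (iterate≡applyUpTo f d q)) (Unique.applyUpTo⁺₁ (iter f d) q distinct))
        sound complete
        where
        sound : ∀ {e} → e ∈ iterate f d q → label e ≡ label d
        sound {e} e∈ with ∈-applyUpTo⁻ (iter f d) (subst (e ∈_) (iterate≡applyUpTo f d q) e∈)
        ... | i , _ , refl = label-iter i d
        complete : ∀ {e} → label e ≡ label d → e ∈ iterate f d q
        complete eq with find-q (sym eq)
        ... | i , i<q , refl = subst (iter f d i ∈_) (sym (iterate≡applyUpTo f d q)) (∈-applyUpTo⁺ (iter f d) i<q)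

      q≡period : q ≡ period d
      q≡period = trans (sym (length-iterate f d q)) (↭-length orbit-q-↭)

  period>0 : ∀ d → 0 < period d
  period>0 d = subst (0 <_) (Return.q≡period d) (proj₁ (proj₂ (leastReturn d)))

  period≤n : ∀ d → period d ≤ n
  period≤n d = subst (_≤ n) (Return.q≡period d) (Return.q≤n d)

  iter-period : ∀ d → iter f d (period d) ≡ d
  iter-period d = subst (λ q → iter f d q ≡ d) (Return.q≡period d) (Return.iter-q d)

  find : ∀ {d e} → label d ≡ label e → ∃ λ i → i < period d × iter f d i ≡ e
  find {d} = subst (λ q → label d ≡ label _ → ∃ λ i → i < q × iter f d i ≡ _)
                   (Return.q≡period d) (Return.find-q d)

  orbit-↭ : ∀ d → iterate f d (period d) ↭ filter (λ e → label e ≟ label d) (allFin n)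
  orbit-↭ d = subst (λ q → iterate f d q ↭ filter (λ e → label e ≟ label d) (allFin n))
                    (Return.q≡period d) (Return.orbit-q-↭ d)

  -- `sector` scans as many iterates as there are darts in all. As `i < period d ≤ n`, the target is
  -- met before the scan ends, and distinctness within a period shows that it is not met earlier.
  takeWhile-iterate : ∀ {d i} → i < period d →
    takeWhile (λ a → ¬? (a ≟ iter f d i)) (iterate f d n) ≡ iterate f d i
  takeWhile-iterate {d} {i} i<q =
    go d i n (ℕ.<-≤-trans i<q (period≤n d))
       λ {j} j<i → Return.distinct d j<i (subst (i <_) (sym (Return.q≡period d)) i<q)
    where
    go : ∀ x i m → i < m → (∀ {j} → j < i → iter f x j ≢ iter f x i) →
         takeWhile (λ a → ¬? (a ≟ iter f x i)) (iterate f x m) ≡ iterate f x i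
    go x zero    (suc m) _   _ with x ≟ x
    ... | yes _  = refl
    ... | no x≢x = ⊥-elim (x≢x refl)
    go x (suc i) (suc m) i<m new with x ≟ iter f (f x) i
    ... | yes eq = ⊥-elim (new (s≤s z≤n) eq)
    ... | no _   = cong (x ∷_) (go (f x) i m (s<s⁻¹ i<m) λ j<i → new (s≤s j<i))

-- Edges and faces of the map as sets of darts

module MapProperties (G : ToroidalMap) where
  open ToroidalMap G

  σ-injective : ∀ {d e} → σ d ≡ σ e → d ≡ e
  σ-injective {d} {e} eq = trans (sym (inverseˡ rotation)) (trans (cong (rotation ⟨$⟩ˡ_) eq) (inverseˡ rotation))

  α-injective : ∀ {d e} → α d ≡ α e → d ≡ e
  α-injective {d} {e} eq = trans (sym (α-involutive d)) (trans (cong α eq) (α-involutive e))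

  σ-φ : ∀ d → σ (φ d) ≡ α d
  σ-φ d = inverseʳ rotation

  φ-injective : ∀ {d e} → φ d ≡ φ e → d ≡ e
  φ-injective {d} {e} eq = α-injective (trans (sym (σ-φ d)) (trans (cong σ eq) (σ-φ e)))

  φ-α-σ : ∀ d → φ (α (σ d)) ≡ d
  φ-α-σ d = trans (cong (rotation ⟨$⟩ˡ_) (α-involutive (σ d))) (inverseˡ rotation)

  module Rotation  = Orbit σ-injective vertices
  module Reversal  = Orbit α-injective edges
  module Contour   = Orbit φ-injective faces

  edge-≡ : ∀ {d e} → edge d ≡ edge e → e ≡ d ⊎ e ≡ α d
  edge-≡ {d} eq = go (Equivalence.to (Orbits.sameOrbit edges) eq)
    where
    go : ∀ {d e} → Star (λ x y → α x ≡ y) d e → e ≡ d ⊎ e ≡ α d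
    go ε = inj₁ refl
    go {d} (refl ◅ s) with go s
    ... | inj₁ eq = inj₂ eq
    ... | inj₂ eq = inj₁ (trans eq (α-involutive d))

  fibre-edge-↭ : ∀ d → d ∷ α d ∷ [] ↭ filter (λ e → edge e ≟ edge d) (allFin darts)
  fibre-edge-↭ d = filter-allFin-↭ (λ e → edge e ≟ edge d)
    ((α-free d ∘ sym ∷ []) ∷ [] ∷ [])
    (λ { (here refl) → refl ; (there (here refl)) → Reversal.label-f d })
    complete
    where
    complete : ∀ {e} → edge e ≡ edge d → e ∈ d ∷ α d ∷ []
    complete eq with edge-≡ (sym eq)
    ... | inj₁ e≡d  = here e≡d
    ... | inj₂ e≡αd = there (here e≡αd)

  -- A sum around a face may therefore be shifted by one dart, which is how the base-dependent
  -- angles cancel in `holonomy-face`.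
  fibre-face-↭ : ∀ f → let fibre = filter (λ d → face d ≟ f) (allFin darts) in map φ fibre ↭ fibre
  fibre-face-↭ f = filter-allFin-↭ in-f? (Unique.map⁺ φ-injective (Unique.filter⁺ in-f? (Unique.allFin⁺ darts)))
    sound
    (λ {d} d∈f → subst (_∈ map φ _) (φ-α-σ d) (∈-map⁺ φ (∈-filter⁺ in-f? (∈-allFin (α (σ d)))
      (trans (sym (Contour.label-f (α (σ d)))) (trans (cong face (φ-α-σ d)) d∈f)))))
    where
    in-f? = λ d → face d ≟ f
    sound : ∀ {d} → d ∈ map φ (filter in-f? (allFin darts)) → face d ≡ f
    sound d∈ with ∈-map⁻ φ d∈
    ... | d′ , d′∈ , refl = trans (Contour.label-f d′) (proj₂ (∈-filter⁻ in-f? {xs = allFin darts} d′∈))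

-- Quarters, angles and holonomy of a 4-orientation

module FourOrientation (G : ToroidalMap) (triangular : ∀ f → ToroidalMap.faceSize G f ≡ 3)
                       (D : AngleOrientation G) (is4Orientation : Is4Orientation G D) where
  open ToroidalMap G
  open MapProperties G
  open Is4Orientation is4Orientation

  quarter : Dart → ℕ
  quarter d = leaving G (D d)

  vertex-sum : ∀ v → ∑ (filter (λ d → tail d ≟ v) (allFin darts)) quarter ≡ 4
  vertex-sum v = begin
    ∑ (filter (λ d → tail d ≟ v) (allFin darts)) quarter
      ≡⟨ ∑-filter (λ d → tail d ≟ v) quarter (allFin darts) ⟩
    ∑[ d ∈ allFin darts ] (if does (tail d ≟ v) then quarter d else 0)
      ≡⟨ ∑-cong (allFin darts) pointwise ⟩
    ∑[ d ∈ allFin darts ] (if does (≡-dec _≟_ _≟_ (source G D d) (inj₁ v)) then 1 else 0)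
      ≡⟨ length-filter (λ d → ≡-dec _≟_ _≟_ (source G D d) (inj₁ v)) (allFin darts) ⟨
    outdegree G D (inj₁ v)
      ≡⟨ primal v ⟩
    4 ∎
    where
    open ≡-Reasoning
    pointwise : ∀ d → (if does (tail d ≟ v) then quarter d else 0)
                      ≡ (if does (≡-dec _≟_ _≟_ (source G D d) (inj₁ v)) then 1 else 0)
    pointwise d with D d
    ... | toPrimal with tail d ≟ v
    ...   | yes _ = refl
    ...   | no _  = refl
    pointwise d | toDual with tail d ≟ v
    ...   | yes _ = refl
    ...   | no _  = refl

  -- Of the three angles of a triangle exactly one leaves the dual-vertex, so the other two leave
  -- their primal-vertices.
  face-sum : ∀ f → ∑ (filter (λ d → face d ≟ f) (allFin darts)) quarter ≡ 2
  face-sum f = ℕ.+-cancelʳ-≡ 1 _ 2 (begin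
    ∑ fibre quarter + 1                                          ≡⟨ cong (∑ fibre quarter +_) primal-sum ⟨
    ∑ fibre quarter + ∑ fibre primals                            ≡⟨ ∑-+ quarter primals fibre ⟨
    ∑[ d ∈ fibre ] (quarter d + primals d)                       ≡⟨ ∑-cong fibre either ⟩
    ∑[ _ ∈ fibre ] 1                                             ≡⟨ ∑-const 1 fibre ⟩
    1 * length fibre                                             ≡⟨ ℕ.*-identityˡ _ ⟩
    length fibre                                                 ≡⟨ triangular f ⟩
    3                                                            ∎)
    where
    open ≡-Reasoning
    fibre = filter (λ d → face d ≟ f) (allFin darts)
    indicator : Target → ℕ
    indicator toPrimal = 1
    indicator toDual   = 0
    primals : Dart → ℕ
    primals d = indicator (D d)
    either : ∀ d → quarter d + primals d ≡ 1
    either d with D d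
    ... | toPrimal = refl
    ... | toDual   = refl
    pointwise : ∀ d → (if does (face d ≟ f) then primals d else 0)
                      ≡ (if does (≡-dec _≟_ _≟_ (source G D d) (inj₂ f)) then 1 else 0)
    pointwise d with D d
    ... | toDual with face d ≟ f
    ...   | yes _ = refl
    ...   | no _  = refl
    pointwise d | toPrimal with face d ≟ f
    ...   | yes _ = refl
    ...   | no _  = refl
    primal-sum : ∑ fibre primals ≡ 1
    primal-sum = begin
      ∑ fibre primals
        ≡⟨ ∑-filter (λ d → face d ≟ f) primals (allFin darts) ⟩
      ∑[ d ∈ allFin darts ] (if does (face d ≟ f) then primals d else 0)
        ≡⟨ ∑-cong (allFin darts) pointwise ⟩
      ∑[ d ∈ allFin darts ] (if does (≡-dec _≟_ _≟_ (source G D d) (inj₂ f)) then 1 else 0)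
        ≡⟨ length-filter (λ d → ≡-dec _≟_ _≟_ (source G D d) (inj₂ f)) (allFin darts) ⟨
      outdegree G D (inj₂ f)
        ≡⟨ dual f ⟩
      1 ∎

  full-turn : ∀ d → ∑ (iterate σ d (Rotation.period d)) quarter ≡ 4
  full-turn d = trans (∑-↭ quarter (Rotation.orbit-↭ d)) (vertex-sum (tail d))

  base : Vertex → Dart
  base v = proj₁ (Orbits.surjective vertices v)

  tail-base : ∀ v → tail (base v) ≡ v
  tail-base v = proj₂ (Orbits.surjective vertices v)

  -- Well defined mod 4 because a full turn has four quarters.
  angle : Dart → ℕ
  angle d = outgoingIn G D (sector G (base (tail d)) d)

  angle-σ : ∀ d → angle (σ d) ≋ angle d + quarter d
  angle-σ d with Rotation.find (tail-base (tail d))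
  ... | i , i<q , iter-i≡d = begin
    outgoingIn G D (sector G (base (tail (σ d))) (σ d))
      ≡⟨ cong (λ v → outgoingIn G D (sector G (base v) (σ d))) (Rotation.label-f d) ⟩
    outgoingIn G D (sector G b (σ d))
      ≈⟨ turn ⟩
    ∑ (iterate σ b (suc i)) quarter
      ≡⟨ step ⟩
    ∑ (iterate σ b i) quarter + quarter d
      ≡⟨ cong (_+ quarter d) (∑-sector i<q iter-i≡d) ⟨
    angle d + quarter d
      ∎
    where
    open ≋-Reasoning
    b = base (tail d)
    ∑-sector : ∀ {j e} → j < Rotation.period b → iter σ b j ≡ e →
               outgoingIn G D (sector G b e) ≡ ∑ (iterate σ b j) quarter
    ∑-sector j<q refl = cong (λ xs → ∑ xs quarter) (Rotation.takeWhile-iterate j<q)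
    iter-suc-i : iter σ b (suc i) ≡ σ d
    iter-suc-i = trans (iter-suc σ i b) (cong σ iter-i≡d)
    step : ∑ (iterate σ b (suc i)) quarter ≡ ∑ (iterate σ b i) quarter + quarter d
    step = ≡R.begin
      ∑ (iterate σ b (suc i)) quarter ≡R.≡⟨ cong (λ m → ∑ (iterate σ b m) quarter) (ℕ.+-comm 1 i) ⟩
      ∑ (iterate σ b (i + 1)) quarter ≡R.≡⟨ cong (λ xs → ∑ xs quarter) (iterate-++ σ i 1 b) ⟩
      ∑ (iterate σ b i ++ iter σ b i ∷ []) quarter ≡R.≡⟨ ∑-++ quarter (iterate σ b i) _ ⟩
      ∑ (iterate σ b i) quarter + (quarter (iter σ b i) + 0)
        ≡R.≡⟨ cong (∑ (iterate σ b i) quarter +_)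
                 (trans (ℕ.+-identityʳ _) (cong quarter iter-i≡d)) ⟩
      ∑ (iterate σ b i) quarter + quarter d ≡R.∎
      where module ≡R = ≡-Reasoning
    turn : outgoingIn G D (sector G b (σ d)) ≋ ∑ (iterate σ b (suc i)) quarter
    turn with suc i ℕ.<? Rotation.period b
    ... | yes 1+i<q = ≋-reflexive (∑-sector 1+i<q iter-suc-i)
    -- Here `d` is the last dart before the base: `σ d` is the base itself, whose sector is empty,
    -- so the angle restarts at 0 where the running sum reaches 4.
    ... | no 1+i≮q with ℕ.≤-antisym i<q (ℕ.≮⇒≥ 1+i≮q)
    ...   | 1+i≡q = begin
      outgoingIn G D (sector G b (σ d))       ≡⟨ ∑-sector {0} (Rotation.period>0 b) closes ⟩
      0                                       ≈⟨ +4*-≋ 0 1 ⟨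
      4                                       ≡⟨ full-turn b ⟨
      ∑ (iterate σ b (Rotation.period b)) quarter ≡⟨ cong (λ m → ∑ (iterate σ b m) quarter) 1+i≡q ⟨
      ∑ (iterate σ b (suc i)) quarter         ∎
      where
      closes : b ≡ σ d
      closes = trans (sym (Rotation.iter-period b)) (trans (cong (iter σ b) (sym 1+i≡q)) iter-suc-i)

  angle-iter : ∀ i d → angle (iter σ d i) ≋ angle d + ∑ (iterate σ d i) quarter
  angle-iter zero    d = ≋-reflexive (sym (ℕ.+-identityʳ (angle d)))
  angle-iter (suc i) d = begin
    angle (iter σ (σ d) i)                              ≈⟨ angle-iter i (σ d) ⟩
    angle (σ d) + ∑ (iterate σ (σ d) i) quarter         ≈⟨ +-congʳ-≋ _ (angle-σ d) ⟩
    angle d + quarter d + ∑ (iterate σ (σ d) i) quarter ≡⟨ ℕ.+-assoc (angle d) _ _ ⟩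
    angle d + ∑ (iterate σ d (suc i)) quarter           ∎
    where open ≋-Reasoning

  angle-sector : ∀ {d e} → tail d ≡ tail e → angle e ≋ angle d + outgoingIn G D (sector G d e)
  angle-sector {d} eq with Rotation.find eq
  ... | i , i<q , refl = begin
    angle (iter σ d i)                           ≈⟨ angle-iter i d ⟩
    angle d + ∑ (iterate σ d i) quarter
      ≡⟨ cong (λ xs → angle d + ∑ xs quarter) (Rotation.takeWhile-iterate i<q) ⟨
    angle d + outgoingIn G D (sector G d (iter σ d i)) ∎
    where open ≋-Reasoning

  -- The two sectors together make one full turn. For equal darts both would be empty, hence
  -- `d ≢ e`.
  sector-complement : ∀ {d e} → tail d ≡ tail e → d ≢ e →
    outgoingIn G D (sector G d e) + outgoingIn G D (sector G e d) ≡ 4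
  sector-complement {d} eq d≢e with Rotation.find eq
  ... | zero  , _   , refl = ⊥-elim (d≢e refl)
  ... | suc i , i<q , refl = begin
    outgoingIn G D (sector G d e) + outgoingIn G D (sector G e d)
      ≡⟨ cong₂ (λ xs ys → ∑ xs quarter + ∑ ys quarter) (Rotation.takeWhile-iterate i<q) backward ⟩
    ∑ (iterate σ d (suc i)) quarter + ∑ (iterate σ e (q ∸ suc i)) quarter
      ≡⟨ ∑-++ quarter (iterate σ d (suc i)) _ ⟨
    ∑ (iterate σ d (suc i) ++ iterate σ e (q ∸ suc i)) quarter
      ≡⟨ cong (λ xs → ∑ xs quarter) (iterate-++ σ (suc i) (q ∸ suc i) d) ⟨
    ∑ (iterate σ d (suc i + (q ∸ suc i))) quarter
      ≡⟨ cong (λ m → ∑ (iterate σ d m) quarter) (ℕ.m+[n∸m]≡n (ℕ.<⇒≤ i<q)) ⟩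
    ∑ (iterate σ d q) quarter
      ≡⟨ full-turn d ⟩
    4 ∎
    where
    open ≡-Reasoning
    q = Rotation.period d
    e = iter σ d (suc i)
    returns : iter σ e (q ∸ suc i) ≡ d
    returns = trans (sym (iter-+ σ (suc i) (q ∸ suc i) d))
                    (trans (cong (iter σ d) (ℕ.m+[n∸m]≡n (ℕ.<⇒≤ i<q))) (Rotation.iter-period d))
    shorter : q ∸ suc i < Rotation.period e
    shorter = subst (λ v → q ∸ suc i < count (λ x → tail x ≟ v)) eq
                    (ℕ.∸-monoʳ-< {q} z<s (ℕ.<⇒≤ i<q))
    backward : sector G e d ≡ iterate σ e (q ∸ suc i)
    backward = trans (cong (sector G e) (sym returns)) (Rotation.takeWhile-iterate shorter)

  -- The turning along d, with angles at both ends measured from the chosen darts;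
  -- 3 stands for − 1.
  holonomy : Dart → ℕ
  holonomy d = 2 + angle d + 3 * angle (α d)

  holonomy-α : ∀ d → holonomy d + holonomy (α d) ≋ 0
  holonomy-α d = begin
    holonomy d + holonomy (α d)
      ≡⟨ cong (λ e → holonomy d + (2 + angle (α d) + 3 * angle e)) (α-involutive d) ⟩
    2 + angle d + 3 * angle (α d) + (2 + angle (α d) + 3 * angle d)
      ≡⟨ collect (angle d) (angle (α d)) ⟩
    0 + 4 * (1 + angle d + angle (α d))
      ≈⟨ +4*-≋ 0 (1 + angle d + angle (α d)) ⟩
    0 ∎
    where
    open ≋-Reasoning
    collect : ∀ a b → 2 + a + 3 * b + (2 + b + 3 * a) ≡ 4 * (1 + a + b)
    collect = solve-∀

  holonomy-edge : ∀ i → ∑ (filter (λ d → edge d ≟ i) (allFin darts)) holonomy ≋ 0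
  holonomy-edge i with Orbits.surjective edges i
  ... | d , refl = begin
    ∑ (filter (λ e → edge e ≟ edge d) (allFin darts)) holonomy ≡⟨ ∑-↭ holonomy (fibre-edge-↭ d) ⟨
    holonomy d + (holonomy (α d) + 0)                          ≡⟨ cong (holonomy d +_) (ℕ.+-identityʳ _) ⟩
    holonomy d + holonomy (α d)                                ≈⟨ holonomy-α d ⟩
    0                                                          ∎
    where open ≋-Reasoning

  -- With the face on the left, the walk passes from `α d` clockwise to `φ d`, undoing
  -- `quarter (φ d)`. Three reversals contribute 6 and the two quarters of the face -2, which makes
  -- 4; with 3 for -1 the sum reads 6 + 6.
  holonomy-face : ∀ f → ∑ (filter (λ d → face d ≟ f) (allFin darts)) holonomy ≋ 0
  holonomy-face f = begin
    ∑ fibre holonomy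
      ≈⟨ ∑-cong-≋ fibre (λ d _ → transport d) ⟩
    ∑[ d ∈ fibre ] (2 + angle d + 3 * (angle (φ d) + quarter (φ d)))
      ≡⟨ ∑-+ (λ d → 2 + angle d) (λ d → 3 * (angle (φ d) + quarter (φ d))) fibre ⟩
    ∑[ d ∈ fibre ] (2 + angle d) + ∑[ d ∈ fibre ] (3 * (angle (φ d) + quarter (φ d)))
      ≡⟨ cong₂ _+_ (∑-+ (λ _ → 2) angle fibre) (∑-* 3 (λ d → angle (φ d) + quarter (φ d)) fibre) ⟩
    (∑[ _ ∈ fibre ] 2) + ∑ fibre angle + 3 * (∑[ d ∈ fibre ] (angle (φ d) + quarter (φ d)))
      ≡⟨ cong₂ (λ x y → x + ∑ fibre angle + 3 * y) twos shift ⟩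
    6 + ∑ fibre angle + 3 * (∑ fibre angle + 2)
      ≡⟨ collect (∑ fibre angle) ⟩
    0 + 4 * (3 + ∑ fibre angle)
      ≈⟨ +4*-≋ 0 (3 + ∑ fibre angle) ⟩
    0 ∎
    where
    open ≋-Reasoning
    fibre = filter (λ d → face d ≟ f) (allFin darts)
    transport : ∀ d → holonomy d ≋ 2 + angle d + 3 * (angle (φ d) + quarter (φ d))
    transport d = +-congˡ-≋ (2 + angle d) (3*-cong-≋
      (≋-trans (≋-reflexive (cong angle (sym (σ-φ d)))) (angle-σ (φ d))))
    twos : ∑[ _ ∈ fibre ] 2 ≡ 6
    twos = trans (∑-const 2 fibre) (cong (2 *_) (triangular f))
    shift : ∑[ d ∈ fibre ] (angle (φ d) + quarter (φ d)) ≡ ∑ fibre angle + 2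
    shift = trans (cong sum (map-∘ fibre)) (trans (∑-↭ (λ d → angle d + quarter d) (fibre-face-↭ f))
              (trans (∑-+ angle quarter fibre) (cong (∑ fibre angle +_) (face-sum f))))
    collect : ∀ a → 6 + a + 3 * (a + 2) ≡ 4 * (3 + a)
    collect = solve-∀

-- Repetitions in lists, and walks with endpoints

findDuplicate : {A : Set} {m : ℕ} (h : A → Fin m) (xs : List A) → Unique (map h xs) ⊎
  (∃ λ ws → ∃ λ x → ∃ λ ys → ∃ λ y → ∃ λ zs → xs ≡ ws ++ x ∷ ys ++ y ∷ zs × h x ≡ h y)
findDuplicate h [] = inj₁ []
findDuplicate h (x ∷ xs) with ∈? _≟_ (h x) (map h xs)
... | yes hx∈ with ∈-map⁻ h hx∈
...   | y , y∈xs , eq with ∈-∃++ y∈xs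
...     | ys , zs , refl = inj₂ ([] , x , ys , y , zs , refl , eq)
findDuplicate h (x ∷ xs) | no hx∉ with findDuplicate h xs
...   | inj₁ unique = inj₁ (All.¬Any⇒All¬ _ hx∉ ∷ unique)
...   | inj₂ (ws , y , ys , z , zs , refl , eq) = inj₂ (x ∷ ws , y , ys , z , zs , refl , eq)

module Walks (G : ToroidalMap) where
  open ToroidalMap G
  open MapProperties G

  -- Unlike `IsClosedWalk` this admits the empty walk and records both ends, as cutting and gluing
  -- require.
  data Walk : Vertex → List Dart → Vertex → Set where
    stay : ∀ {u} → Walk u [] u
    step : ∀ {u d C v} → u ≡ tail d → Walk (head d) C v → Walk u (d ∷ C) v

  walk-++ : ∀ {u v w} {C C′} → Walk u C v → Walk v C′ w → Walk u (C ++ C′) w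
  walk-++ stay        q = q
  walk-++ (step eq p) q = step eq (walk-++ p q)

  walk-++⁻ : ∀ C {C′} {u w} → Walk u (C ++ C′) w → ∃ λ v → Walk u C v × Walk v C′ w
  walk-++⁻ []      p = _ , stay , p
  walk-++⁻ (d ∷ C) (step eq p) with walk-++⁻ C p
  ... | v , q , r = v , step eq q , r

  closed⇒isClosedWalk : ∀ {u d C} → Walk u (d ∷ C) u → IsClosedWalk G (d ∷ C)
  closed⇒isClosedWalk {d = d} p@(step eq _) = (λ ()) , go p eq
    where
    go : ∀ {u v x xs} → Walk u (x ∷ xs) v → v ≡ tail d →
         All (uncurry λ a b → head a ≡ tail b) (zip (x ∷ xs) (xs ∷ʳ d))
    go (step _ stay)          eq = eq ∷ []
    go (step _ q@(step eq′ _)) eq = eq′ ∷ go q eq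

  -- Going straight back would repeat an edge, and a loop on its own is its own successor, which
  -- `α-free` settles. This provides the hypothesis `d ≢ e` of `sector-complement` at every turn of
  -- a cycle. The second assumption of `go` serves the closing turn, from the last dart to `d`.
  turn≢back : ∀ d C → Unique (map edge (d ∷ C)) → All (uncurry λ a b → α a ≢ b) (turns G (d ∷ C))
  turn≢back d C unique@(d∉ ∷ _) =
    go d C (AllPairs.map⁻ unique) (inj₁ refl ∷ All.map (λ ≢ → inj₂ (≢ ∘ sym)) (All.map⁻ d∉))
    where
    go : ∀ x xs → AllPairs (λ a b → edge a ≢ edge b) (x ∷ xs) →
         All (λ a → a ≡ d ⊎ edge a ≢ edge d) (x ∷ xs) →
         All (uncurry λ a b → α a ≢ b) (zip (x ∷ xs) (xs ∷ʳ d))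
    go x []       _                 (inj₁ x≡d ∷ _)  = (λ eq → α-free x (trans eq (sym x≡d))) ∷ []
    go x []       _                 (inj₂ x≢d ∷ _)  =
      (λ eq → x≢d (trans (sym (Reversal.label-f x)) (cong edge eq))) ∷ []
    go x (y ∷ ys) ((x≢y ∷ _) ∷ pairs) (_ ∷ all) =
      (λ eq → x≢y (trans (sym (Reversal.label-f x)) (cong edge eq))) ∷ go y ys pairs all

-- Vanishing of the holonomy of closed walks

module Balanced (G : ToroidalMap) (triangular : ∀ f → ToroidalMap.faceSize G f ≡ 3)
                (D : AngleOrientation G) (isBalanced : IsBalanced4Orientation G D) where
  open ToroidalMap G
  open MapProperties G
  open Walks G
  open IsBalanced4Orientation isBalanced
  open FourOrientation G triangular D is4Orientation

  -- The sum over all darts with a face of `R` on their left vanishes face by face. Those with `R`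
  -- on both sides come in opposite pairs and cancel edge by edge; what is left is `C`.
  holonomy-boundary : ∀ {C} (R : Subset (Orbits.size faces)) → Unique C →
    (∀ d → d ∈ C ⇔ (face d ∈ˢ R × face (α d) ∉ˢ R)) → ∑ C holonomy ≋ 0
  holonomy-boundary {C} R unique boundary = begin
    ∑ C holonomy                                     ≡⟨ ℕ.+-identityʳ _ ⟨
    ∑ C holonomy + 0                                 ≈⟨ +-congˡ-≋ (∑ C holonomy) inner ⟨
    ∑ C holonomy + ∑ (filter both? (allFin darts)) holonomy
      ≡⟨ cong (_+ ∑ (filter both? (allFin darts)) holonomy) (∑-↭ holonomy C-↭) ⟩
    ∑ (filter boundary? (allFin darts)) holonomy + ∑ (filter both? (allFin darts)) holonomy
      ≡⟨ ∑-filter-split left? right? holonomy (allFin darts) ⟨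
    ∑ (filter left? (allFin darts)) holonomy
      ≈⟨ ∑-fibres-≋0 face (Orbits.surjective faces) holonomy holonomy-face left? (λ eq → subst (_∈ˢ R) eq) ⟩
    0 ∎
    where
    open ≋-Reasoning
    left?     = λ d → face d ∈ˢ? R
    right?    = λ d → face (α d) ∈ˢ? R
    both?     = λ d → left? d ×-dec right? d
    boundary? = λ d → left? d ×-dec ¬? (right? d)
    C-↭ : C ↭ filter boundary? (allFin darts)
    C-↭ = filter-allFin-↭ boundary? unique (Equivalence.to (boundary _)) (Equivalence.from (boundary _))
    both-resp : ∀ {d e} → edge d ≡ edge e → face d ∈ˢ R × face (α d) ∈ˢ R → face e ∈ˢ R × face (α e) ∈ˢ R
    both-resp {d} eq (l , r) with edge-≡ eq
    ... | inj₁ refl = l , r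
    ... | inj₂ refl = r , subst (λ x → face x ∈ˢ R) (sym (α-involutive d)) l
    inner : ∑ (filter both? (allFin darts)) holonomy ≋ 0
    inner = ∑-fibres-≋0 edge (Orbits.surjective edges) holonomy holonomy-edge both? both-resp

  holonomy-map-α : ∀ C → ∑ C holonomy + ∑ (map α C) holonomy ≋ 0
  holonomy-map-α []      = ≋-refl
  holonomy-map-α (d ∷ C) = begin
    holonomy d + ∑ C holonomy + (holonomy (α d) + ∑ (map α C) holonomy)
      ≡⟨ interchange (holonomy d) (∑ C holonomy) (holonomy (α d)) (∑ (map α C) holonomy) ⟩
    holonomy d + holonomy (α d) + (∑ C holonomy + ∑ (map α C) holonomy)
      ≈⟨ +-cong-≋ (holonomy-α d) (holonomy-map-α C) ⟩
    0 ∎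
    where
    open ≋-Reasoning
    interchange : ∀ a b c e → a + b + (c + e) ≡ a + c + (b + e)
    interchange = solve-∀

  holonomy-contractible : ∀ {C} → Unique C → Contractible G C → ∑ C holonomy ≋ 0
  holonomy-contractible unique (inj₁ disk) = holonomy-boundary region unique boundary
    where open EnclosesDiskOnLeft disk
  -- With the disk on the right it is the reversed cycle that bounds. `reverse` only permutes its
  -- darts, and `α` negates each holonomy.
  holonomy-contractible {C} unique (inj₂ disk) = begin
    ∑ C holonomy                           ≡⟨ ℕ.+-identityʳ _ ⟨
    ∑ C holonomy + 0                       ≈⟨ +-congˡ-≋ (∑ C holonomy) reversed ⟨
    ∑ C holonomy + ∑ (map α C) holonomy    ≈⟨ holonomy-map-α C ⟩
    0                                      ∎
    where
    open ≋-Reasoning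
    open EnclosesDiskOnLeft disk
    reversed : ∑ (map α C) holonomy ≋ 0
    reversed = holonomy-boundary region (Unique.map⁺ α-injective unique) λ d → mk⇔
      (Equivalence.to (boundary d) ∘ ∈-resp-↭ (↭-sym (↭-reverse (map α C))))
      (∈-resp-↭ (↭-reverse (map α C)) ∘ Equivalence.from (boundary d))

  -- Regrouped by turns, the angles at each vertex combine into the number of quarters on the right
  -- of the turn. Right and left add up to 4 at each of the k vertices, so `γ ≡ 0` makes the right
  -- total 2k. The k reversals give another 2k, and the sum is 4k.
  holonomy-γ≡0 : ∀ {C} → IsCycle G C → γ G D C ≡ 0ℤ → ∑ C holonomy ≋ 0
  holonomy-γ≡0 {[]}     isCycle _   = ≋-refl
  holonomy-γ≡0 {d ∷ ds} isCycle γ≡0 = begin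
    ∑ (d ∷ ds) holonomy
      ≡⟨ regroup ⟨
    ∑[ t ∈ ts ] (2 + 3 * angle (α (proj₁ t)) + angle (proj₂ t))
      ≈⟨ ∑-cong-≋ ts (λ t t∈ts → turn (lookup (proj₂ closedWalk) t∈ts)) ⟩
    ∑[ t ∈ ts ] (2 + right t)
      ≡⟨ ∑-+ (λ _ → 2) right ts ⟩
    (∑[ _ ∈ ts ] 2) + ∑ ts right
      ≡⟨ cong₂ _+_ (∑-const 2 ts) right≡2k ⟩
    2 * length ts + 2 * length ts
      ≡⟨ double (length ts) ⟩
    0 + 4 * length ts
      ≈⟨ +4*-≋ 0 (length ts) ⟩
    0 ∎
    where
    open ≋-Reasoning
    open IsCycle isCycle
    ts = turns G (d ∷ ds)
    right left : Dart × Dart → ℕ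
    right (a , b) = outgoingIn G D (sector G (α a) b)
    left  (a , b) = outgoingIn G D (sector G b (α a))
    double : ∀ k → 2 * k + 2 * k ≡ 4 * k
    double = solve-∀
    turn : ∀ {a b} → head a ≡ tail b → 2 + 3 * angle (α a) + angle b ≋ 2 + right (a , b)
    turn {a} {b} eq = begin
      2 + 3 * angle (α a) + angle b                       ≈⟨ +-congˡ-≋ (2 + 3 * angle (α a)) (angle-sector eq) ⟩
      2 + 3 * angle (α a) + (angle (α a) + right (a , b)) ≡⟨ collect (angle (α a)) _ ⟩
      2 + right (a , b) + 4 * angle (α a)                 ≈⟨ +4*-≋ _ (angle (α a)) ⟩
      2 + right (a , b)                                   ∎
      where
      collect : ∀ x r → 2 + 3 * x + (x + r) ≡ 2 + r + 4 * x
      collect = solve-∀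
    regroup : ∑[ t ∈ ts ] (2 + 3 * angle (α (proj₁ t)) + angle (proj₂ t)) ≡ ∑ (d ∷ ds) holonomy
    regroup = trans (∑-zip-rotate (λ a → 2 + 3 * angle (α a)) angle d d ds)
      (trans (cong (∑ (d ∷ ds) (λ a → 2 + 3 * angle (α a)) +_) (ℕ.+-comm (∑ ds angle) (angle d)))
      (trans (sym (∑-+ (λ a → 2 + 3 * angle (α a)) angle (d ∷ ds)))
             (∑-cong (d ∷ ds) λ a → swap (angle (α a)) (angle a))))
      where
      swap : ∀ x y → 2 + 3 * x + y ≡ 2 + y + 3 * x
      swap = solve-∀
    around : ∀ {t} → t ∈ ts → right t + left t ≡ 4
    around t∈ts = sector-complement (lookup (proj₂ closedWalk) t∈ts)
                                    (lookup (turn≢back d ds distinctEdges) t∈ts)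
    total : ∀ {us} → (∀ {t} → t ∈ us → right t + left t ≡ 4) → ∑ us right + ∑ us left ≡ 4 * length us
    total {us} eq = trans (sym (∑-+ right left us)) (trans (sum-4 us eq) (∑-const 4 us))
      where
      sum-4 : ∀ us → (∀ {t} → t ∈ us → right t + left t ≡ 4) →
              ∑[ t ∈ us ] (right t + left t) ≡ ∑[ _ ∈ us ] 4
      sum-4 []       eq = refl
      sum-4 (u ∷ us) eq = cong₂ _+_ (eq (here refl)) (sum-4 us (eq ∘ there))
    left≡right : ∑ ts left ≡ ∑ ts right
    left≡right = sym (ℤ.+-injective (ℤ.i-j≡0⇒i≡j _ _ (trans (ℤ.m-n≡m⊖n (∑ ts right) (∑ ts left)) γ≡0)))
    right≡2k : ∑ ts right ≡ 2 * length ts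
    right≡2k = ℕ.*-cancelˡ-≡ _ _ 2 (≡R.begin
      2 * ∑ ts right           ≡R.≡⟨ cong (∑ ts right +_) (trans (ℕ.+-identityʳ _) (sym left≡right)) ⟩
      ∑ ts right + ∑ ts left   ≡R.≡⟨ total around ⟩
      4 * length ts            ≡R.≡⟨ ℕ.*-assoc 2 2 (length ts) ⟩
      2 * (2 * length ts)      ≡R.∎)
      where module ≡R = ≡-Reasoning

  holonomy-cycle : ∀ {C} → IsCycle G C → ∑ C holonomy ≋ 0
  -- Whether `C` is contractible is never decided. A non-zero holonomy would rule out
  -- contractibility, and then `balanced` makes it zero; congruence is decidable, so this refutation
  -- suffices.
  holonomy-cycle {C} isCycle = decidable-stable (∑ C holonomy ≋? 0) λ ≢0 →
    ≢0 (holonomy-γ≡0 isCycle (balanced C isCycle λ contractible →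
      ≢0 (holonomy-contractible (Unique.map⁻ (IsCycle.distinctEdges isCycle)) contractible)))

  -- The induction is on a bound for the length, since the pieces are not sublists in a structural
  -- sense. Repeated edges need a cut of their own: going along a non-loop edge and straight back
  -- repeats no tail, yet is not a cycle.
  holonomy-closed : ∀ {u C} → Walk u C u → ∑ C holonomy ≋ 0
  holonomy-closed {C = C} = go (length C) ℕ.≤-refl
    where
    split-length : ∀ {n} (X : List Dart) {d} Y {e} Z → length (X ++ d ∷ Y ++ e ∷ Z) ≤ suc n →
                   suc (length X + length Y + length Z) ≤ n
    split-length {n} X {d} Y {e} Z len = s≤s⁻¹ (subst (_≤ suc n) (trans
      (trans (length-++ X) (cong (λ m → length X + suc m) (length-++ Y)))
      (shift (length X) (length Y) (length Z))) len)
      where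
      shift : ∀ a b c → a + suc (b + suc c) ≡ suc (suc (a + b + c))
      shift = solve-∀
    go : ∀ {u C} n → length C ≤ n → Walk u C u → ∑ C holonomy ≋ 0
    go {C = []} _ _ _ = ≋-refl
    go {u} {C@(d₀ ∷ ds)} (suc n) len p = cases (findDuplicate tail C) (findDuplicate edge C)
      where
      cutAtVertex : ∀ X d Y e Z → C ≡ X ++ d ∷ Y ++ e ∷ Z → tail d ≡ tail e → ∑ C holonomy ≋ 0
      cutAtVertex X d Y e Z eq td≡te with walk-++⁻ X (subst (λ L → Walk u L u) eq p)
      ... | _ , before , step refl p′ with walk-++⁻ Y p′
      ...   | _ , loop , step refl after = begin
        ∑ C holonomy
          ≡⟨ cong (λ L → ∑ L holonomy) eq ⟩
        ∑ (X ++ d ∷ Y ++ e ∷ Z) holonomy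
          ≡⟨ ∑-++ holonomy X _ ⟩
        ∑ X holonomy + (holonomy d + ∑ (Y ++ e ∷ Z) holonomy)
          ≡⟨ cong (λ s → ∑ X holonomy + (holonomy d + s)) (∑-++ holonomy Y _) ⟩
        ∑ X holonomy + (holonomy d + (∑ Y holonomy + ∑ (e ∷ Z) holonomy))
          ≡⟨ regroup (∑ X holonomy) (holonomy d) (∑ Y holonomy) (∑ (e ∷ Z) holonomy) ⟩
        holonomy d + ∑ Y holonomy + (∑ X holonomy + ∑ (e ∷ Z) holonomy)
          ≡⟨ cong (holonomy d + ∑ Y holonomy +_) (∑-++ holonomy X _) ⟨
        ∑ (d ∷ Y) holonomy + ∑ (X ++ e ∷ Z) holonomy
          ≈⟨ +-cong-≋
               (go n (ℕ.≤-trans (s≤s (ℕ.≤-trans (ℕ.m≤n+m (length Y) (length X)) (ℕ.m≤m+n _ _))) bound)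
                   (subst (λ w → Walk (tail d) (d ∷ Y) w) (sym td≡te) (step refl loop)))
               (go n (ℕ.≤-trans (ℕ.≤-reflexive (trans (length-++ X) (ℕ.+-suc (length X) (length Z))))
                        (ℕ.≤-trans (s≤s (ℕ.+-monoˡ-≤ (length Z) (ℕ.m≤m+n (length X) (length Y)))) bound))
                   (walk-++ before (step td≡te after))) ⟩
        0 ∎
        where
        open ≋-Reasoning
        bound = split-length X Y Z (subst (λ L → length L ≤ suc n) eq len)
        regroup : ∀ a b c e → a + (b + (c + e)) ≡ b + c + (a + e)
        regroup = solve-∀
      -- Deleting both traversals of the edge leaves `Y`, closed at `head d`, and `X ++ Z`, closed
      -- because `α d` returns to `tail d`. Either may be empty.
      cutBacktrack : ∀ X d Y Z → C ≡ X ++ d ∷ Y ++ α d ∷ Z → ∑ C holonomy ≋ 0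
      cutBacktrack X d Y Z eq with walk-++⁻ X (subst (λ L → Walk u L u) eq p)
      ... | _ , before , step refl p′ with walk-++⁻ Y p′
      ...   | _ , loop , step refl after = begin
        ∑ C holonomy
          ≡⟨ cong (λ L → ∑ L holonomy) eq ⟩
        ∑ (X ++ d ∷ Y ++ α d ∷ Z) holonomy
          ≡⟨ ∑-++ holonomy X _ ⟩
        ∑ X holonomy + (holonomy d + ∑ (Y ++ α d ∷ Z) holonomy)
          ≡⟨ cong (λ s → ∑ X holonomy + (holonomy d + s)) (∑-++ holonomy Y _) ⟩
        ∑ X holonomy + (holonomy d + (∑ Y holonomy + (holonomy (α d) + ∑ Z holonomy)))
          ≡⟨ regroup (∑ X holonomy) (holonomy d) (∑ Y holonomy) (holonomy (α d)) (∑ Z holonomy) ⟩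
        holonomy d + holonomy (α d) + (∑ Y holonomy + (∑ X holonomy + ∑ Z holonomy))
          ≡⟨ cong (λ s → holonomy d + holonomy (α d) + (∑ Y holonomy + s)) (∑-++ holonomy X _) ⟨
        holonomy d + holonomy (α d) + (∑ Y holonomy + ∑ (X ++ Z) holonomy)
          ≈⟨ +-cong-≋ (holonomy-α d) (+-cong-≋
               (go n (ℕ.≤-trans (ℕ.≤-trans (ℕ.m≤n+m (length Y) (length X)) (ℕ.m≤m+n _ _)) (ℕ.<⇒≤ bound)) loop)
               (go n (ℕ.≤-trans (ℕ.≤-reflexive (length-++ X))
                        (ℕ.≤-trans (ℕ.+-monoˡ-≤ (length Z) (ℕ.m≤m+n (length X) (length Y))) (ℕ.<⇒≤ bound)))
                   (walk-++ before (subst (λ x → Walk (tail x) Z u) (α-involutive d) after)))) ⟩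
        0 ∎
        where
        open ≋-Reasoning
        bound = split-length X Y Z (subst (λ L → length L ≤ suc n) eq len)
        regroup : ∀ a b c e g → a + (b + (c + (e + g))) ≡ b + e + (c + (a + g))
        regroup = solve-∀
      cases : _ → _ → ∑ C holonomy ≋ 0
      cases (inj₂ (X , d , Y , e , Z , eq , td≡te)) _ = cutAtVertex X d Y e Z eq td≡te
      cases (inj₁ _) (inj₂ (X , d , Y , e , Z , eq , ed≡ee)) with edge-≡ ed≡ee
      ... | inj₁ refl = cutAtVertex X d Y e Z eq refl
      ... | inj₂ refl = cutBacktrack X d Y Z eq
      cases (inj₁ !tails) (inj₁ !edges) = holonomy-cycle record
        { closedWalk       = closed⇒isClosedWalk p
        ; distinctVertices = !tails
        ; distinctEdges    = !edges
        }

-- Kinds of darts as values in ℤ/4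

-- A quarter turn counterclockwise leads from one kind to the next.
toKind : ℕ → Heading × Colour
toKind 0 = outgoing , blue
toKind 1 = outgoing , red
toKind 2 = incoming , blue
toKind 3 = incoming , red
toKind (suc (suc (suc (suc n)))) = toKind n

toKind-cong : ∀ {m n} → m ≋ n → toKind m ≡ toKind n
toKind-cong {m} {n} (mod≡ eq) = trans (reduce m) (trans (cong toKind eq) (sym (reduce n)))
  where
  multiple : ∀ k r → toKind (k * 4 + r) ≡ toKind r
  multiple zero    r = refl
  multiple (suc k) r = multiple k r
  reduce : ∀ n → toKind n ≡ toKind (n % 4)
  reduce n = trans (cong toKind (trans (m≡m%n+[m/n]*n n 4) (ℕ.+-comm (n % 4) _))) (multiple (n / 4) (n % 4))

opposite : Heading → Heading
opposite outgoing = incoming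
opposite incoming = outgoing

toKind-2+ : ∀ n → toKind (2 + n) ≡ (opposite (proj₁ (toKind n)) , proj₂ (toKind n))
toKind-2+ 0 = refl
toKind-2+ 1 = refl
toKind-2+ 2 = refl
toKind-2+ 3 = refl
toKind-2+ (suc (suc (suc (suc n)))) = toKind-2+ n

colour-suc : ∀ n → proj₂ (toKind n) ≢ proj₂ (toKind (suc n))
colour-suc 0 ()
colour-suc 1 ()
colour-suc 2 ()
colour-suc 3 ()
colour-suc (suc (suc (suc (suc n)))) = colour-suc n

-- The structure's orientation will agree with the given one pointwise only, so each count is
-- transported instead of the orientation itself.
balanced-resp-≗ : ∀ {G D D′} → (∀ a → D′ a ≡ D a) → IsBalanced4Orientation G D → IsBalanced4Orientation G D′
balanced-resp-≗ {G} {D} {D′} D′≗D isBalanced = record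
  { is4Orientation = record
    { primal = λ v → trans (outdegree-cong (inj₁ v)) (primal v)
    ; dual   = λ f → trans (outdegree-cong (inj₂ f)) (dual f)
    }
  ; balanced = λ C isCycle ¬contractible → trans (γ-cong C) (balanced C isCycle ¬contractible)
  }
  where
  open ToroidalMap G
  open IsBalanced4Orientation isBalanced
  open Is4Orientation is4Orientation
  source-cong : ∀ a → source G D′ a ≡ source G D a
  source-cong a with D′ a | D a | D′≗D a
  ... | toDual   | _ | refl = refl
  ... | toPrimal | _ | refl = refl
  outdegree-cong : ∀ x → outdegree G D′ x ≡ outdegree G D x
  outdegree-cong x = cong length (filter-≐ (λ a → ≡-dec _≟_ _≟_ (source G D′ a) x)
                                           (λ a → ≡-dec _≟_ _≟_ (source G D a) x)
    ((λ {a} → trans (sym (source-cong a))) , (λ {a} → trans (source-cong a))) (allFin darts))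
  outgoingIn-cong : ∀ as → outgoingIn G D′ as ≡ outgoingIn G D as
  outgoingIn-cong as = ∑-cong as (λ a → cong (leaving G) (D′≗D a))
  γ-cong : ∀ C → γ G D′ C ≡ γ G D C
  γ-cong C = cong₂ _⊖_ (∑-cong (turns G C) λ (d , e) → outgoingIn-cong (sector G (α d) e))
                       (∑-cong (turns G C) λ (d , e) → outgoingIn-cong (sector G e (α d)))

-- Construction of the transversal structure

module Construction (G : ToroidalMap) (triangular : ∀ f → ToroidalMap.faceSize G f ≡ 3)
                    (D : AngleOrientation G) (isBalanced : IsBalanced4Orientation G D) where
  open ToroidalMap G
  open MapProperties G
  open Walks G
  open Balanced G triangular D isBalanced
  open FourOrientation G triangular D (IsBalanced4Orientation.is4Orientation isBalanced)

  star⇒walk : ∀ {d e} → Star (λ x y → σ x ≡ y ⊎ α x ≡ y) d e → ∃ λ C → Walk (tail d) C (tail e)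
  star⇒walk ε = [] , stay
  star⇒walk {d} {e} (inj₁ refl ◅ s) with star⇒walk s
  ... | C , p = C , subst (λ v → Walk v C (tail e)) (Rotation.label-f d) p
  star⇒walk {d} (inj₂ refl ◅ s) with star⇒walk s
  ... | C , p = d ∷ C , step refl p

  root : Dart
  root = fromℕ< (>-nonZero⁻¹ darts)

  fromRoot : ∀ v → ∃ λ C → Walk (tail root) C v
  fromRoot v = subst (λ w → ∃ λ C → Walk (tail root) C w) (tail-base v) (star⇒walk (connected root (base v)))

  toRoot : ∀ v → ∃ λ C → Walk v C (tail root)
  toRoot v = subst (λ w → ∃ λ C → Walk w C (tail root)) (tail-base v) (star⇒walk (connected (base v) root))

  -- The primitive of the 1-form `holonomy`; modulo four it does not depend on the chosen walk.
  potential : Vertex → ℕ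
  potential v = ∑ (proj₁ (fromRoot v)) holonomy

  -- One walk from `v` back to the root closes both the chosen walk to `v` and the chosen walk to
  -- `u` followed by `C`. Comparing these two closed walks avoids reversing any walk.
  potential-walk : ∀ {u C v} → Walk u C v → potential v ≋ potential u + ∑ C holonomy
  potential-walk {u} {C} {v} p = +-cancelʳ-≋ (∑ back holonomy) (begin
    potential v + ∑ back holonomy
      ≡⟨ ∑-++ holonomy (proj₁ (fromRoot v)) back ⟨
    ∑ (proj₁ (fromRoot v) ++ back) holonomy
      ≈⟨ holonomy-closed (walk-++ (proj₂ (fromRoot v)) (proj₂ (toRoot v))) ⟩
    0
      ≈⟨ holonomy-closed (walk-++ (proj₂ (fromRoot u)) (walk-++ p (proj₂ (toRoot v)))) ⟨
    ∑ (proj₁ (fromRoot u) ++ C ++ back) holonomy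
      ≡⟨ ∑-++ holonomy (proj₁ (fromRoot u)) (C ++ back) ⟩
    potential u + ∑ (C ++ back) holonomy
      ≡⟨ cong (potential u +_) (∑-++ holonomy C back) ⟩
    potential u + (∑ C holonomy + ∑ back holonomy)
      ≡⟨ ℕ.+-assoc (potential u) (∑ C holonomy) (∑ back holonomy) ⟨
    potential u + ∑ C holonomy + ∑ back holonomy ∎)
    where
    open ≋-Reasoning
    back = proj₁ (toRoot v)

  -- Another base dart would shift `angle` by a constant at its vertex. The potential matches these
  -- constants between vertices, so that reversal adds exactly 2 in `direction-α`.
  direction : Dart → ℕ
  direction d = potential (tail d) + angle d

  direction-σ : ∀ d → direction (σ d) ≋ direction d + quarter d
  direction-σ d = begin
    potential (tail (σ d)) + angle (σ d)       ≡⟨ cong (λ v → potential v + angle (σ d)) (Rotation.label-f d) ⟩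
    potential (tail d) + angle (σ d)           ≈⟨ +-congˡ-≋ (potential (tail d)) (angle-σ d) ⟩
    potential (tail d) + (angle d + quarter d) ≡⟨ ℕ.+-assoc (potential (tail d)) (angle d) (quarter d) ⟨
    direction d + quarter d                    ∎
    where open ≋-Reasoning

  direction-α : ∀ d → direction (α d) ≋ 2 + direction d
  direction-α d = begin
    potential (head d) + angle (α d)
      ≈⟨ +-congʳ-≋ (angle (α d)) (potential-walk (step refl stay)) ⟩
    potential (tail d) + (holonomy d + 0) + angle (α d)
      ≡⟨ collect (potential (tail d)) (angle d) (angle (α d)) ⟩
    2 + direction d + 4 * angle (α d)
      ≈⟨ +4*-≋ (2 + direction d) (angle (α d)) ⟩
    2 + direction d ∎
    where
    open ≋-Reasoning
    collect : ∀ p a b → p + (2 + a + 3 * b + 0) + b ≡ 2 + (p + a) + 4 * b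
    collect = solve-∀

  direction-toPrimal : ∀ {a} → D a ≡ toPrimal → direction (σ a) ≋ direction a
  direction-toPrimal {a} eq = ≋-trans (direction-σ a) (≋-reflexive
    (trans (cong (λ t → direction a + leaving G t) eq) (ℕ.+-identityʳ (direction a))))

  direction-toDual : ∀ {a} → D a ≡ toDual → direction (σ a) ≋ suc (direction a)
  direction-toDual {a} eq = ≋-trans (direction-σ a) (≋-reflexive
    (trans (cong (λ t → direction a + leaving G t) eq) (ℕ.+-comm (direction a) 1)))

  representative : Edge → Dart
  representative i = proj₁ (Orbits.surjective edges i)

  along : Heading → Dart → Dart
  along outgoing d = d
  along incoming d = α d

  edge-along : ∀ h d → edge (along h d) ≡ edge d
  edge-along outgoing d = refl
  edge-along incoming d = Reversal.label-f d

  orientedColouring : OrientedColouring G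
  orientedColouring = record
    { colour      = λ i → proj₂ (toKind (direction (representative i)))
    ; orient      = λ i → along (proj₁ (toKind (direction (representative i)))) (representative i)
    ; orient-edge = λ i → trans (edge-along (proj₁ (toKind (direction (representative i)))) (representative i))
                                (proj₂ (Orbits.surjective edges i))
    }

  open OrientedColouring orientedColouring using (colour; kind)

  heading-along : ∀ h {d e} → d ≡ e → (if does (along h e ≟ d) then outgoing else incoming) ≡ h
  heading-along outgoing {d} refl with d ≟ d
  ... | yes _  = refl
  ... | no d≢d = ⊥-elim (d≢d refl)
  heading-along incoming {d} refl with α d ≟ d
  ... | yes eq = ⊥-elim (α-free d eq)
  ... | no _   = refl

  heading-along-α : ∀ h {d e} → d ≡ α e → (if does (along h e ≟ d) then outgoing else incoming) ≡ opposite h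
  heading-along-α outgoing {e = e} refl with e ≟ α e
  ... | yes eq = ⊥-elim (α-free e (sym eq))
  ... | no _   = refl
  heading-along-α incoming {e = e} refl with α e ≟ α e
  ... | yes _  = refl
  ... | no ≢   = ⊥-elim (≢ refl)

  -- Heading and colour were read off at one representative of each edge. The opposite dart differs
  -- by 2 in direction, which keeps the colour and swaps the heading, so the formula holds for both
  -- darts.
  kind≡ : ∀ d → kind d ≡ toKind (direction d)
  kind≡ d with edge-≡ (proj₂ (Orbits.surjective edges (edge d)))
  ... | inj₁ d≡r = trans
    (cong (_, colour (edge d)) (heading-along (proj₁ (toKind (direction (representative (edge d))))) d≡r))
    (cong (toKind ∘ direction) (sym d≡r))
  ... | inj₂ d≡αr = begin
    kind d
      ≡⟨ cong (_, colour (edge d)) (heading-along-α (proj₁ (toKind (direction r))) d≡αr) ⟩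
    (opposite (proj₁ (toKind (direction r))) , proj₂ (toKind (direction r)))
      ≡⟨ toKind-2+ (direction r) ⟨
    toKind (2 + direction r)
      ≡⟨ toKind-cong (direction-α r) ⟨
    toKind (direction (α r))
      ≡⟨ cong (toKind ∘ direction) d≡αr ⟨
    toKind (direction d) ∎
    where
    open ≡-Reasoning
    r = representative (edge d)

  -- A full turn has positive sum, so some angle leaves the vertex, and the direction is constant up
  -- to the first one.
  nextToDual : ∀ d → ∃ λ a → tail a ≡ tail d × D a ≡ toDual × direction a ≋ direction d
  nextToDual d = go (Rotation.period d) d (full-turn d)
    where
    go : ∀ {r} n d → ∑ (iterate σ d n) quarter ≡ suc r →
         ∃ λ a → tail a ≡ tail d × D a ≡ toDual × direction a ≋ direction d
    go (suc n) d sum≡ with D d in eq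
    ... | toDual   = d , refl , eq , ≋-refl
    ... | toPrimal with go n (σ d) sum≡
    ...   | a , ta≡ , Da≡ , ≋σd = a , trans ta≡ (Rotation.label-f d) , Da≡ , ≋-trans ≋σd (direction-toPrimal eq)

  reachToDual : ∀ n d → ∃ λ a → tail a ≡ tail d × D a ≡ toDual × direction a ≋ n + direction d
  reachToDual zero    d = nextToDual d
  reachToDual (suc n) d with reachToDual n d
  ... | a , ta≡ , Da≡ , a≋ with nextToDual (σ a)
  ...   | b , tb≡ , Db≡ , b≋ = b , trans tb≡ (trans (Rotation.label-f a) ta≡) , Db≡ ,
    ≋-trans b≋ (≋-trans (direction-toDual Da≡) (+-congˡ-≋ 1 a≋))

  -- A run of darts of one kind, cut just after the first angle that leaves the vertex; it contains
  -- the dart of that angle, hence `suc size`. The run uses up one quarter and leaves `r`, and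
  -- `end≡` remembers where the whole list stops.
  record Block (d : Dart) (n r : ℕ) : Set where
    field
      {size}       : ℕ
      {next}       : Dart
      {remaining}  : ℕ
      kinds        : map kind (iterate σ d n)
                     ≡ replicate (suc size) (toKind (direction d)) ++ map kind (iterate σ next remaining)
      direction≋   : direction next ≋ suc (direction d)
      sum≡         : ∑ (iterate σ next remaining) quarter ≡ r
      end≡         : iter σ next remaining ≡ iter σ d n

  block : ∀ n {r} d → ∑ (iterate σ d n) quarter ≡ suc r → Block d n r
  block (suc n) d total with D d in eq
  ... | toDual = record
    { size       = 0
    ; kinds      = cong (_∷ map kind (iterate σ (σ d) n)) (kind≡ d)
    ; direction≋ = direction-toDual eq
    ; sum≡       = ℕ.suc-injective total
    ; end≡       = refl
    }
  ... | toPrimal = record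
    { size       = suc size
    ; kinds      = cong₂ _∷_ (kind≡ d) (trans kinds
        (cong (λ k → replicate (suc size) k ++ map kind (iterate σ next remaining))
              (toKind-cong (direction-toPrimal eq))))
    ; direction≋ = ≋-trans direction≋ (+-congˡ-≋ 1 (direction-toPrimal eq))
    ; sum≡       = sum≡
    ; end≡       = end≡
    }
    where open Block (block n (σ d) total)

  -- A non-empty list ending just before `σ a` has `a` as its last entry, and the angle at `a`
  -- counts one. After four blocks nothing can therefore remain to be listed.
  no-quarters : ∀ n {d a} → ∑ (iterate σ d n) quarter ≡ 0 → iter σ d n ≡ σ a → D a ≡ toDual → n ≡ 0
  no-quarters zero    _ _ _ = refl
  no-quarters (suc n) {d} {a} sum≡0 end≡ Da≡
    with no-quarters n {σ d} (ℕ.m+n≡0⇒n≡0 (quarter d) sum≡0) end≡ Da≡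
  ... | refl with trans (cong (leaving G) (sym (trans (cong D (σ-injective end≡)) Da≡)))
                        (ℕ.m+n≡0⇒m≡0 (quarter d) sum≡0)
  ...   | ()

  fourBlocks : ∀ n {d a} → direction d ≋ 0 → ∑ (iterate σ d n) quarter ≡ 4 →
    iter σ d n ≡ σ a → D a ≡ toDual → ∃ λ i → ∃ λ j → ∃ λ k → ∃ λ l →
    map kind (iterate σ d n)
      ≡ replicate (suc i) (outgoing , blue) ++ replicate (suc j) (outgoing , red)
     ++ replicate (suc k) (incoming , blue) ++ replicate (suc l) (incoming , red)
  fourBlocks n {d} ≋0 total end≡σa Da≡toDual = split (block n d total)
    where
    open Block
    split : Block d n 3 → _
    split b₀ = size b₀ , size b₁ , size b₂ , size b₃ ,
      trans (chain b₀ ≋0) (cong (replicate (suc (size b₀)) (outgoing , blue) ++_)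
      (trans (chain b₁ ≋1) (cong (replicate (suc (size b₁)) (outgoing , red) ++_)
      (trans (chain b₂ ≋2) (cong (replicate (suc (size b₂)) (incoming , blue) ++_)
      (trans (chain b₃ ≋3) (trans (cong (λ m → replicate (suc (size b₃)) (incoming , red)
                                               ++ map kind (iterate σ (next b₃) m)) end)
                                  (++-identityʳ _))))))))
      where
      chain : ∀ {d n r m} (b : Block d n r) → direction d ≋ m → map kind (iterate σ d n) ≡
              replicate (suc (size b)) (toKind m) ++ map kind (iterate σ (next b) (remaining b))
      chain b p = trans (kinds b) (cong (λ k → replicate (suc (size b)) k ++ _) (toKind-cong p))
      b₁ : Block (next b₀) (remaining b₀) 2
      b₁ = block (remaining b₀) (next b₀) (sum≡ b₀)
      b₂ : Block (next b₁) (remaining b₁) 1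
      b₂ = block (remaining b₁) (next b₁) (sum≡ b₁)
      b₃ : Block (next b₂) (remaining b₂) 0
      b₃ = block (remaining b₂) (next b₂) (sum≡ b₂)
      ≋1 : direction (next b₀) ≋ 1
      ≋1 = ≋-trans (direction≋ b₀) (+-congˡ-≋ 1 ≋0)
      ≋2 : direction (next b₁) ≋ 2
      ≋2 = ≋-trans (direction≋ b₁) (+-congˡ-≋ 1 ≋1)
      ≋3 : direction (next b₂) ≋ 3
      ≋3 = ≋-trans (direction≋ b₂) (+-congˡ-≋ 1 ≋2)
      end : remaining b₃ ≡ 0
      end = no-quarters (remaining b₃) (sum≡ b₃)
        (trans (end≡ b₃) (trans (end≡ b₂) (trans (end≡ b₁) (trans (end≡ b₀) end≡σa)))) Da≡toDual

  -- The list has to start right after an angle that ends the incoming red edges.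
  lastAngle : ∀ v → ∃ λ a → tail a ≡ v × D a ≡ toDual × direction (σ a) ≋ 0
  lastAngle v = a , trans ta≡ (tail-base v) , Da≡toDual , (begin
    direction (σ a)       ≈⟨ direction-toDual Da≡toDual ⟩
    suc (direction a)     ≈⟨ +-congˡ-≋ 1 a≋ ⟩
    suc (3 + 3 * x + x)   ≡⟨ collect x ⟩
    0 + 4 * (1 + x)       ≈⟨ +4*-≋ 0 (1 + x) ⟩
    0                     ∎)
    where
    open ≋-Reasoning
    x = direction (base v)
    -- Advancing by `3 + 3 * x` from `x` gives `3 + 4 * x`, so the direction reached is 3, incoming
    -- red, whatever `x` is.
    reached = reachToDual (3 + 3 * x) (base v)
    a = proj₁ reached
    ta≡ = proj₁ (proj₂ reached)
    Da≡toDual = proj₁ (proj₂ (proj₂ reached))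
    a≋ = proj₂ (proj₂ (proj₂ reached))
    collect : ∀ x → suc (3 + 3 * x + x) ≡ 0 + 4 * (1 + x)
    collect = solve-∀

  transversal : ∀ v → TransversalAt G orientedColouring v
  transversal v = start (lastAngle v)
    where
    start : (∃ λ a → tail a ≡ v × D a ≡ toDual × direction (σ a) ≋ 0) → _
    start (a , refl , Da≡toDual , ≋0) = σ a , Rotation.label-f a ,
      fourBlocks (degree (tail a)) ≋0
        (subst (λ n → ∑ (iterate σ (σ a) n) quarter ≡ 4) period≡degree (full-turn (σ a)))
        (subst (λ n → iter σ (σ a) n ≡ σ a) period≡degree (Rotation.iter-period (σ a)))
        Da≡toDual
      where
      period≡degree : Rotation.period (σ a) ≡ degree (tail a)
      period≡degree = cong degree (Rotation.label-f a)

  structure : TransversalStructure G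
  structure = record { orientedColouring = orientedColouring ; transversal = transversal }

  -- Colour is the parity of the direction: it stays the same over an angle toward the vertex and
  -- changes over one that leaves it.
  corresponding≗ : ∀ a → corresponding G structure a ≡ D a
  corresponding≗ a with D a in eq | colour (edge a) ≟ᶜ colour (edge (σ a))
  ... | toPrimal | yes _ = refl
  ... | toDual   | no _  = refl
  ... | toPrimal | no ≢  = ⊥-elim (≢ (cong proj₂ (trans (kind≡ a)
    (trans (sym (toKind-cong (direction-toPrimal eq))) (sym (kind≡ (σ a)))))))
  ... | toDual   | yes c≡ = ⊥-elim (colour-suc (direction a) (trans (sym (cong proj₂ (kind≡ a)))
    (trans c≡ (cong proj₂ (trans (kind≡ (σ a)) (toKind-cong (direction-toDual eq)))))))

corollary1 : (G : ToroidalTriangulation) →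
    let open ToroidalTriangulation G using (toroidalMap) in
    (D : AngleOrientation toroidalMap) → IsBalanced4Orientation toroidalMap D →
    ∃ λ (T : TransversalStructure toroidalMap) →
    IsBalancedStructure toroidalMap T × (∀ a → corresponding toroidalMap T a ≡ D a)
corollary1 G D isBalanced = structure , balanced-resp-≗ corresponding≗ isBalanced , corresponding≗
  where
  open ToroidalTriangulation G
  open Construction toroidalMap triangular D isBalanced
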